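{- Let $n\ge 1$, and let $f:R(\mathcal{HS}_{2n-1})\to\mathfrak S_n\times\mathfrak S_n$, $f(A)=(\sigma_A,\tau_A)$, be the bijection described in the context. Define the sign of a region $A\in R(\mathcal{HS}_{2n-1})$ by $\varepsilon(A)=\operatorname{sgn}(\sigma_A)\operatorname{sgn}(\tau_A)$. Then $$\sum_{A\in R(\mathcal{HS}_{2n-1})}\varepsilon(A)\,t^{\operatorname{cyc}(\sigma_A)+\operatorname{cyc}(\tau_A)-1}=t\prod_{i=1}^{n-1}(t-i)^2.$$
   Context: $\mathcal{HS}_{2n-1}$ is the hyperplane arrangement in $\mathbb R^{2n-1}$ with coordinates $(\mathbf x,\mathbf y)=(x_1,\dots,x_n,y_1,\dots,y_{n-1})$ given by $\{x_i-x_j=0:1\le i<j\le n\}\cup\{x_i-x_j=y_i:1\le i<j\le n\}$. $R(\mathcal{HS}_{2n-1})$ is its set of regions (connected components of the complement in $\mathbb R^{2n-1}$ of the union of the hyperplanes). The map $f$: for a region $A$, $\sigma_A\in\mathfrak S_n$ is the unique permutation with $x_{\sigma_A(1)}<x_{\sigma_A(2)}<\cdots<x_{\sigma_A(n)}$ for all $(\mathbf x,\mathbf y)\in A$. For $1\le i<n$ put $\ell_i(A)=\#\{j>i:y_i>x_i-x_j\}$ (the same for all points of $A$), and $\ell_n(A)=0$, so $0\le\ell_i(A)\le n-i$. Then $\tau_A\in\mathfrak S_n$ is the permutation with Lehmer code $(\ell_1(A),\dots,\ell_n(A))$, i.e. $\tau_A(i)$ is the $(\ell_i(A)+1)$-th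 smallest element of $\{1,\dots,n\}\setminus\{\tau_A(1),\dots,\tau_A(i-1)\}$. Here $\operatorname{cyc}(\pi)$ denotes the number of cycles of $\pi\in\mathfrak S_n$ (including fixed points) and $\operatorname{sgn}$ the sign of a permutation. -}

module Defs where

open import Level using (0ℓ; _⊔_) renaming (suc to lsuc)
open import Algebra.Bundles using (CommutativeRing)
open import Data.Bool.Base using (if_then_else_)
open import Data.Empty using (⊥-elim)
open import Data.Fin.Base as Fin using (Fin; zero; suc; toℕ; fromℕ; inject₁; punchIn; _↑ˡ_; _↑ʳ_)
import Data.Fin.Properties as Fin
open import Data.Fin.Permutation using (Permutation′; _⟨$⟩ʳ_; insert; insert-punchIn; inverseˡ) renaming (id to idₚ)
open import Data.Fin.Relation.Unary.Top using (view; ‵fromℕ; ‵inject₁; view-fromℕ; view-inject₁)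
open import Data.List.Base using (length; deduplicate; allFin)
open import Data.Nat.Base as ℕ using (ℕ; zero; suc; _∸_; s≤s; z≤n)
import Data.Nat.Properties as ℕ
open import Data.Nat.GeneralisedArithmetic using (fold)
open import Data.Product using (Σ-syntax; ∃; ∃-syntax; _×_; _,_; proj₁; proj₂)
open import Data.Rational.Base as ℚ using (ℚ; 0ℚ; ½)
import Data.Rational.Properties as ℚ
open import Data.Rational.Solver using (module +-*-Solver)
open import Data.Sum.Base using (_⊎_; inj₁; inj₂)
open import Data.Vec.Functional using (Vector)
open import Function.Base using (_∘_)
open import Function.Bundles using (Inverse)
open import Relation.Binary.Bundles using (Setoid)
open import Relation.Binary.Core using (Rel)
open import Relation.Binary.Definitions using (Transitive; tri<; tri≈; tri>)
open import Relation.Binary.PropositionalEquality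
  using (_≡_; _≢_; refl; sym; trans; cong; cong₂; subst; subst₂; setoid)
open import Relation.Nullary using (¬_; Dec; yes; no; does; contradiction; _×-dec_)
open import Relation.Unary using (Pred; Decidable; _⊆_; _∪_)
import Algebra.Properties.CommutativeMonoid.Sum as Sum
import Algebra.Properties.Semiring.Exp as Exp
import Algebra.Properties.Semiring.Mult as Mult

open Sum ℕ.+-0-commutativeMonoid using () renaming (sum to sumℕ; sum-permute to sumℕ-permute)

private
  variable
    m n d : ℕ

------------------------------------------------------------------------
-- Real numbers: Cauchy sequences of rationals.  Two sequences denote the
-- same real when neither is smaller than the other; equality of reals is
-- only used through its positive negation, the apartness _#_.

record ℝ : Set where
  no-eta-equality
  field
    seq    : ℕ → ℚ
    -- m and n play symmetric roles, so this bounds ∣ seq m - seq n ∣.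
    cauchy : ∀ ε → 0ℚ ℚ.< ε → ∃[ N ] ∀ m n → N ℕ.≤ m → N ℕ.≤ n → seq m ℚ.- seq n ℚ.< ε

open ℝ

infix 4 _<ℝ_ _#_
infixl 6 _-ℝ_

record _<ℝ_ (a b : ℝ) : Set where
  constructor gap
  field
    ε         : ℚ
    ε-pos     : 0ℚ ℚ.< ε
    N         : ℕ
    separated : ∀ n → N ℕ.≤ n → seq a n ℚ.+ ε ℚ.< seq b n

_#_ : ℝ → ℝ → Set
a # b = a <ℝ b ⊎ b <ℝ a

half : ℚ → ℚ
half ε = ½ ℚ.* ε

half>0 : ∀ {ε} → 0ℚ ℚ.< ε → 0ℚ ℚ.< half ε
half>0 {ε} 0<ε = subst (ℚ._< half ε) (ℚ.*-zeroʳ ½) (ℚ.*-monoʳ-<-pos ½ {0ℚ} {ε} 0<ε)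

halves : ∀ ε → half ε ℚ.+ half ε ≡ ε
halves ε = trans (sym (ℚ.*-distribʳ-+ ε ½ ½)) (ℚ.*-identityˡ ε)

add-< : ∀ p q r s → p ℚ.< q → r ℚ.< s → p ℚ.+ r ℚ.< q ℚ.+ s
add-< p q r s = ℚ.+-mono-< {p} {q} {r} {s}

shift-< : ∀ p q r → p ℚ.< q → p ℚ.+ r ℚ.< q ℚ.+ r
shift-< p q r = ℚ.+-monoˡ-< r {p} {q}

pos-+ : ∀ p q → 0ℚ ℚ.< p → 0ℚ ℚ.< q → 0ℚ ℚ.< p ℚ.+ q
pos-+ p q 0<p 0<q = subst (ℚ._< p ℚ.+ q) (ℚ.+-identityʳ 0ℚ) (add-< 0ℚ p 0ℚ q 0<p 0<q)

drop : ∀ r s e → 0ℚ ℚ.< e → r ℚ.+ e ℚ.< s → r ℚ.< s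
drop r s e 0<e h = ℚ.<-trans {r} {r ℚ.+ e} {s}
  (subst (ℚ._< r ℚ.+ e) (ℚ.+-identityʳ r) (ℚ.+-monoʳ-< r {0ℚ} {e} 0<e)) h

resp-< : ∀ p q r s → p ≡ r → q ≡ s → p ℚ.< q → r ℚ.< s
resp-< p q .p .q refl refl p<q = p<q

fromℚ : ℚ → ℝ
fromℚ q .seq n        = q
fromℚ q .cauchy ε 0<ε = 0 , λ _ _ _ _ → subst (ℚ._< ε) (sym (ℚ.+-inverseʳ q)) 0<ε

0ℝ : ℝ
0ℝ = fromℚ 0ℚ

_-ℝ_ : ℝ → ℝ → ℝ
(a -ℝ b) .seq n        = seq a n ℚ.- seq b n
(a -ℝ b) .cauchy ε 0<ε =
  let (N , p) = cauchy a (half ε) (half>0 0<ε)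
      (M , q) = cauchy b (half ε) (half>0 0<ε)
  in N ℕ.⊔ M , λ m n N≤m N≤n →
    resp-< _ _ _ _ (regroup (seq a m) (seq a n) (seq b m) (seq b n)) (halves ε)
      (add-< (seq a m ℚ.- seq a n) (half ε) (seq b n ℚ.- seq b m) (half ε)
        (p m n (ℕ.m⊔n≤o⇒m≤o N M N≤m) (ℕ.m⊔n≤o⇒m≤o N M N≤n))
        (q n m (ℕ.m⊔n≤o⇒n≤o N M N≤n) (ℕ.m⊔n≤o⇒n≤o N M N≤m)))
  where
  open +-*-Solver
  regroup : ∀ a b c d → (a ℚ.- b) ℚ.+ (d ℚ.- c) ≡ (a ℚ.- c) ℚ.- (b ℚ.- d)
  regroup = solve 4 (λ a b c d → (a :- b) :+ (d :- c) := (a :- c) :- (b :- d)) refl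

<ℝ-asym : ∀ {a b} → a <ℝ b → ¬ (b <ℝ a)
<ℝ-asym {a} {b} (gap ε 0<ε N p) (gap δ 0<δ M q) =
  ℚ.<-asym (drop (seq a k) (seq b k) ε 0<ε (p k (ℕ.m≤m⊔n N M)))
           (drop (seq b k) (seq a k) δ 0<δ (q k (ℕ.m≤n⊔m N M)))
  where
  k = N ℕ.⊔ M

<ℝ-trans : Transitive _<ℝ_
<ℝ-trans {a} {b} {c} (gap ε 0<ε N p) (gap δ 0<δ M q) =
  gap ε 0<ε (N ℕ.⊔ M) λ n h →
    ℚ.<-trans (p n (ℕ.m⊔n≤o⇒m≤o N M h))
              (drop (seq b n) (seq c n) δ 0<δ (q n (ℕ.m⊔n≤o⇒n≤o N M h)))

#⇒dec : ∀ {a b} → a # b → Dec (a <ℝ b)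
#⇒dec (inj₁ a<b) = yes a<b
#⇒dec (inj₂ b<a) = no λ a<b → <ℝ-asym a<b b<a

------------------------------------------------------------------------
ℝ^_ : ℕ → Set
ℝ^ d = Vector ℝ d

-- ∣ a - b ∣ < ε
record Near (ε : ℚ) (a b : ℝ) : Set where
  constructor near
  field
    below : a -ℝ b <ℝ fromℚ ε
    above : b -ℝ a <ℝ fromℚ ε

-- Relative openness in C, with respect to the sup-norm.
OpenIn : Pred (ℝ^ d) 0ℓ → Pred (ℝ^ d) 0ℓ → Set
OpenIn C U = ∀ p → C p → U p →
  ∃[ ε ] 0ℚ ℚ.< ε × (∀ q → C q → (∀ k → Near ε (p k) (q k)) → U q)

-- No two relatively open sets that cover C and both meet C are disjoint
-- within C (stated positively).
Connected : Pred (ℝ^ d) 0ℓ → Set₁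
Connected {d} C = (U V : Pred (ℝ^ d) 0ℓ) → OpenIn C U → OpenIn C V → C ⊆ U ∪ V →
  (∃[ p ] C p × U p) → (∃[ p ] C p × V p) → ∃[ p ] C p × U p × V p

-- p and q lie in the same connected component of X.
Joined : Pred (ℝ^ d) 0ℓ → Rel (ℝ^ d) (lsuc 0ℓ)
Joined {d} X p q = Σ[ C ∈ Pred (ℝ^ d) 0ℓ ] Connected C × (C ⊆ X) × C p × C q

joined-refl : ∀ {X : Pred (ℝ^ d) 0ℓ} {p} → X p → Joined X p p
joined-refl {p = p} Xp = (_≡ p) , conn , (λ { refl → Xp }) , refl , refl
  where
  conn : Connected (_≡ p)
  conn U V _ _ _ (_ , refl , u) (_ , refl , v) = p , refl , u , v

joined-sym : ∀ {X : Pred (ℝ^ d) 0ℓ} {p q} → Joined X p q → Joined X q p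
joined-sym (C , conn , sub , Cp , Cq) = C , conn , sub , Cq , Cp

joined-trans : ∀ {X : Pred (ℝ^ d) 0ℓ} {p q r} → Joined X p q → Joined X q r → Joined X p r
joined-trans {X = X} {q = q} (C , connC , C⊆X , Cp , Cq) (D , connD , D⊆X , Dq , Dr) =
  C ∪ D , conn , (λ { (inj₁ c) → C⊆X c ; (inj₂ e) → D⊆X e }) , inj₁ Cp , inj₂ Dr
  where
  restrictˡ : ∀ {W} → OpenIn (C ∪ D) W → OpenIn C W
  restrictˡ o p c w = let (ε , 0<ε , h) = o p (inj₁ c) w in ε , 0<ε , λ q c′ → h q (inj₁ c′)

  restrictʳ : ∀ {W} → OpenIn (C ∪ D) W → OpenIn D W
  restrictʳ o p e w = let (ε , 0<ε , h) = o p (inj₂ e) w in ε , 0<ε , λ q e′ → h q (inj₂ e′)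

  conn : Connected (C ∪ D)
  conn U V oU oV cov = go (cov (inj₁ Cq))
    where
    inC : (∃[ p ] C p × U p) → (∃[ p ] C p × V p) → ∃[ p ] (C ∪ D) p × U p × V p
    inC u v = let (z , c , w) = connC U V (restrictˡ oU) (restrictˡ oV) (cov ∘ inj₁) u v in z , inj₁ c , w
    inD : (∃[ p ] D p × U p) → (∃[ p ] D p × V p) → ∃[ p ] (C ∪ D) p × U p × V p
    inD u v = let (z , c , w) = connD U V (restrictʳ oU) (restrictʳ oV) (cov ∘ inj₂) u v in z , inj₂ c , w
    go : U q ⊎ V q → (∃[ p ] (C ∪ D) p × U p) → (∃[ p ] (C ∪ D) p × V p) → ∃[ p ] (C ∪ D) p × U p × V p
    go (inj₁ Uq) _ (v , inj₁ Cv , Vv) = inC (q , Cq , Uq) (v , Cv , Vv)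
    go (inj₁ Uq) _ (v , inj₂ Dv , Vv) = inD (q , Dq , Uq) (v , Dv , Vv)
    go (inj₂ Vq) (u , inj₁ Cu , Uu) _ = inC (u , Cu , Uu) (q , Cq , Vq)
    go (inj₂ Vq) (u , inj₂ Du , Uu) _ = inD (u , Du , Uu) (q , Dq , Vq)

Continuous : (ℝ^ d → ℝ) → Set
Continuous F = ∀ p ε → 0ℚ ℚ.< ε →
  ∃[ δ ] 0ℚ ℚ.< δ × (∀ q → (∀ k → Near δ (p k) (q k)) → Near ε (F p) (F q))

coord-continuous : (k : Fin d) → Continuous {d} (λ p → p k)
coord-continuous k p ε 0<ε = ε , 0<ε , λ q h → h k

const-continuous : ∀ a → Continuous {d} (λ _ → a)
const-continuous a p ε 0<ε = ε , 0<ε , λ q h → near self self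
  where
  self : a -ℝ a <ℝ fromℚ ε
  self = gap (half ε) (half>0 0<ε) 0 λ n _ →
    resp-< _ _ _ _ (cong (ℚ._+ half ε) (sym (ℚ.+-inverseʳ (seq a n)))) (halves ε)
      (shift-< 0ℚ (half ε) (half ε) (half>0 0<ε))

near-mono : ∀ {a b δ ε} → δ ℚ.≤ ε → Near δ a b → Near ε a b
near-mono {a} {b} {δ} {ε} δ≤ε (near h k) = near (widen h) (widen k)
  where
  widen : ∀ {c} → c <ℝ fromℚ δ → c <ℝ fromℚ ε
  widen (gap η 0<η N p) = gap η 0<η N λ n N≤n → ℚ.<-≤-trans (p n N≤n) δ≤ε

near-sub : ∀ {a b c e} ε → Near (half ε) a b → Near (half ε) c e → Near ε (a -ℝ c) (b -ℝ e)
near-sub {a} {b} {c} {e} ε (near a-b b-a) (near c-e e-c) = near (add a b c e a-b e-c) (add b a e c b-a c-e)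
  where
  open +-*-Solver
  shuffle : ∀ a b c e η ν →
    ((a ℚ.- b) ℚ.+ η) ℚ.+ ((e ℚ.- c) ℚ.+ ν) ≡ ((a ℚ.- c) ℚ.- (b ℚ.- e)) ℚ.+ (η ℚ.+ ν)
  shuffle = solve 6 (λ a b c e η ν →
    ((a :- b) :+ η) :+ ((e :- c) :+ ν) := ((a :- c) :- (b :- e)) :+ (η :+ ν)) refl
  add : ∀ a b c e → a -ℝ b <ℝ fromℚ (half ε) → e -ℝ c <ℝ fromℚ (half ε) →
        (a -ℝ c) -ℝ (b -ℝ e) <ℝ fromℚ ε
  add a b c e (gap η 0<η N p) (gap ν 0<ν M q) =
    gap (η ℚ.+ ν) (pos-+ η ν 0<η 0<ν) (N ℕ.⊔ M) λ n h →
      resp-< _ _ _ _ (shuffle (seq a n) (seq b n) (seq c n) (seq e n) η ν) (halves ε)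
        (add-< ((seq a n ℚ.- seq b n) ℚ.+ η) (half ε) ((seq e n ℚ.- seq c n) ℚ.+ ν) (half ε) (p n (ℕ.m⊔n≤o⇒m≤o N M h)) (q n (ℕ.m⊔n≤o⇒n≤o N M h)))

⊓-pos : ∀ {δ ε} → 0ℚ ℚ.< δ → 0ℚ ℚ.< ε → 0ℚ ℚ.< δ ℚ.⊓ ε
⊓-pos {δ} {ε} 0<δ 0<ε = select (ℚ.⊓-sel δ ε)
  where
  select : ∀ {μ} → μ ≡ δ ⊎ μ ≡ ε → 0ℚ ℚ.< μ
  select (inj₁ refl) = 0<δ
  select (inj₂ refl) = 0<ε

<ℝ-stable : ∀ {a b} → a <ℝ b →
  ∃[ δ ] 0ℚ ℚ.< δ × (∀ u v → Near δ a u → Near δ b v → u <ℝ v)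
<ℝ-stable {a} {b} (gap ε 0<ε N p) = δ , 0<δ , close
  where
  open +-*-Solver
  η = half ε
  δ = half η
  0<η = half>0 0<ε
  0<δ = half>0 0<η
  lhs : ∀ a b u v ε → ((u ℚ.- a) ℚ.+ (b ℚ.- v)) ℚ.+ (a ℚ.+ ε) ℚ.+ (v ℚ.- b ℚ.- half ε)
        ≡ u ℚ.+ half ε
  lhs = solve 5 (λ a b u v ε →
    ((u :- a) :+ (b :- v)) :+ (a :+ ε) :+ (v :- b :- con ½ :* ε) := u :+ con ½ :* ε) refl
  rhs : ∀ b v ε → (half (half ε) ℚ.+ half (half ε)) ℚ.+ b ℚ.+ (v ℚ.- b ℚ.- half ε) ≡ v
  rhs = solve 3 (λ b v ε →
    (con ½ :* (con ½ :* ε) :+ con ½ :* (con ½ :* ε)) :+ b :+ (v :- b :- con ½ :* ε) := v) refl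
  close : ∀ u v → Near δ a u → Near δ b v → u <ℝ v
  close u v (near _ (gap e₁ 0<e₁ N₁ p₁)) (near (gap e₂ 0<e₂ N₂ p₂) _) =
    gap η 0<η (N ℕ.⊔ (N₁ ℕ.⊔ N₂)) λ n h →
      let h′ = ℕ.m⊔n≤o⇒n≤o N (N₁ ℕ.⊔ N₂) h
          aₙ = seq a n ; bₙ = seq b n ; uₙ = seq u n ; vₙ = seq v n
      in
      resp-< _ _ _ _ (lhs aₙ bₙ uₙ vₙ ε) (rhs bₙ vₙ ε)
        (shift-< ((uₙ ℚ.- aₙ) ℚ.+ (bₙ ℚ.- vₙ) ℚ.+ (aₙ ℚ.+ ε)) (δ ℚ.+ δ ℚ.+ bₙ) (vₙ ℚ.- bₙ ℚ.- η)
          (add-< ((uₙ ℚ.- aₙ) ℚ.+ (bₙ ℚ.- vₙ)) (δ ℚ.+ δ) (aₙ ℚ.+ ε) bₙ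
            (add-< (uₙ ℚ.- aₙ) δ (bₙ ℚ.- vₙ) δ
              (drop (uₙ ℚ.- aₙ) δ e₁ 0<e₁ (p₁ n (ℕ.m⊔n≤o⇒m≤o N₁ N₂ h′)))
              (drop (bₙ ℚ.- vₙ) δ e₂ 0<e₂ (p₂ n (ℕ.m⊔n≤o⇒n≤o N₁ N₂ h′))))
            (p n (ℕ.m⊔n≤o⇒m≤o N _ h))))

sub-continuous : ∀ {F G : ℝ^ d → ℝ} → Continuous F → Continuous G → Continuous (λ p → F p -ℝ G p)
sub-continuous {F = F} {G} cF cG p ε 0<ε =
  let (δ , 0<δ , f) = cF p (half ε) (half>0 0<ε)
      (γ , 0<γ , g) = cG p (half ε) (half>0 0<ε)
  in δ ℚ.⊓ γ , ⊓-pos 0<δ 0<γ , λ q h →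
     near-sub ε
       (f q λ k → near-mono (ℚ.p⊓q≤p δ γ) (h k))
       (g q λ k → near-mono (ℚ.p⊓q≤q δ γ) (h k))

<ℝ-open : ∀ {F G : ℝ^ d → ℝ} → Continuous F → Continuous G →
  (C : Pred (ℝ^ d) 0ℓ) → OpenIn C (λ p → F p <ℝ G p)
<ℝ-open {F = F} {G} cF cG C p _ lt =
  let (ε , 0<ε , s) = <ℝ-stable lt
      (δ , 0<δ , f) = cF p ε 0<ε
      (γ , 0<γ , g) = cG p ε 0<ε
  in δ ℚ.⊓ γ , ⊓-pos 0<δ 0<γ , λ q _ h →
     s (F q) (G q) (f q λ k → near-mono (ℚ.p⊓q≤p δ γ) (h k))
                   (g q λ k → near-mono (ℚ.p⊓q≤q δ γ) (h k))

-- A connected component off the hypersurface F = G lies on one side of it.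
same-side : ∀ {F G : ℝ^ d → ℝ} → Continuous F → Continuous G →
  ∀ {X : Pred (ℝ^ d) 0ℓ} → (∀ {z} → X z → F z # G z) →
  ∀ {p q} → Joined X p q → F p <ℝ G p → F q <ℝ G q
same-side {F = F} {G} cF cG off {p} {q} (C , conn , C⊆X , Cp , Cq) lt with off (C⊆X Cq)
... | inj₁ lt′ = lt′
... | inj₂ gt  =
  let (z , _ , z< , z>) = conn (λ z → F z <ℝ G z) (λ z → G z <ℝ F z)
                            (<ℝ-open {F = F} {G} cF cG C) (<ℝ-open {F = G} {F} cG cF C) (λ c → off (C⊆X c))
                            (p , Cp , lt) (q , Cq , gt)
  in ⊥-elim (<ℝ-asym z< z>)

------------------------------------------------------------------------
-- Throughout, n = suc m, so that ℝ²ⁿ⁻¹ = ℝ^ (suc m + m), with coordinates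
-- (x₁, …, xₙ, y₁, …, yₙ₋₁) indexed from 0.

xᶜ : ∀ m → ℝ^ (suc m ℕ.+ m) → Fin (suc m) → ℝ
xᶜ m p i = p (i ↑ˡ m)

yᶜ : ∀ m → ℝ^ (suc m ℕ.+ m) → Fin m → ℝ
yᶜ m p i = p (suc m ↑ʳ i)

-- The complement of the hyperplanes xᵢ - xⱼ = 0 and xᵢ - xⱼ = yᵢ; being off a
-- hyperplane is expressed by apartness.
OffHyperplanes : ∀ m → Pred (ℝ^ (suc m ℕ.+ m)) 0ℓ
OffHyperplanes m p =
  (∀ {i j : Fin (suc m)} → i Fin.< j → (xᶜ m p i -ℝ xᶜ m p j) # 0ℝ) ×
  (∀ {i : Fin m} {j : Fin (suc m)} → inject₁ i Fin.< j → (xᶜ m p (inject₁ i) -ℝ xᶜ m p j) # yᶜ m p i)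

-- A region is represented by any of its points; _∼_ identifies the points of
-- one connected component of the complement.
record Region (m : ℕ) : Set where
  field
    point : ℝ^ (suc m ℕ.+ m)
    off   : OffHyperplanes m point

  x : Fin (suc m) → ℝ
  x = xᶜ m point

  y : Fin m → ℝ
  y = yᶜ m point

open Region public using (x; y)

infix 4 _∼_

_∼_ : Rel (Region m) (lsuc 0ℓ)
_∼_ {m} A B = Joined (OffHyperplanes m) (Region.point A) (Region.point B)

HS : ℕ → Setoid 0ℓ (lsuc 0ℓ)
HS m = record
  { Carrier       = Region m
  ; _≈_           = _∼_
  ; isEquivalence = record
    { refl  = λ {A} → joined-refl (Region.off A)
    ; sym   = joined-sym
    ; trans = joined-trans
    }
  }

sub<0⇒< : ∀ a b → a -ℝ b <ℝ 0ℝ → a <ℝ b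
sub<0⇒< a b (gap ε 0<ε N p) = gap ε 0<ε N λ n h →
  resp-< _ _ _ _ (l (seq a n) (seq b n) ε) (ℚ.+-identityˡ (seq b n))
    (shift-< ((seq a n ℚ.- seq b n) ℚ.+ ε) 0ℚ (seq b n) (p n h))
  where
  open +-*-Solver
  l : ∀ a b ε → ((a ℚ.- b) ℚ.+ ε) ℚ.+ b ≡ a ℚ.+ ε
  l = solve 3 (λ a b ε → ((a :- b) :+ ε) :+ b := a :+ ε) refl

0<sub⇒> : ∀ a b → 0ℝ <ℝ a -ℝ b → b <ℝ a
0<sub⇒> a b (gap ε 0<ε N p) = gap ε 0<ε N λ n h →
  resp-< _ _ _ _ (l (seq b n) ε) (r (seq a n) (seq b n))
    (shift-< (0ℚ ℚ.+ ε) (seq a n ℚ.- seq b n) (seq b n) (p n h))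
  where
  open +-*-Solver
  l : ∀ b ε → (0ℚ ℚ.+ ε) ℚ.+ b ≡ b ℚ.+ ε
  l = solve 2 (λ b ε → (con 0ℚ :+ ε) :+ b := b :+ ε) refl
  r : ∀ a b → (a ℚ.- b) ℚ.+ b ≡ a
  r = solve 2 (λ a b → (a :- b) :+ b := a) refl

off⇒# : ∀ p → OffHyperplanes m p → ∀ {i j} → i ≢ j → xᶜ m p i # xᶜ m p j
off⇒# {m} p (off , _) {i} {j} i≢j with ℕ.<-cmp (toℕ i) (toℕ j)
... | tri< i<j _ _ = decide (off i<j)
  where
  decide : (xᶜ m p i -ℝ xᶜ m p j) # 0ℝ → xᶜ m p i # xᶜ m p j
  decide (inj₁ lt) = inj₁ (sub<0⇒< (xᶜ m p i) (xᶜ m p j) lt)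
  decide (inj₂ gt) = inj₂ (0<sub⇒> (xᶜ m p i) (xᶜ m p j) gt)
... | tri≈ _ eq _ = contradiction (Fin.toℕ-injective eq) i≢j
... | tri> _ _ j<i = decide (off j<i)
  where
  decide : (xᶜ m p j -ℝ xᶜ m p i) # 0ℝ → xᶜ m p i # xᶜ m p j
  decide (inj₁ lt) = inj₂ (sub<0⇒< (xᶜ m p j) (xᶜ m p i) lt)
  decide (inj₂ gt) = inj₁ (0<sub⇒> (xᶜ m p j) (xᶜ m p i) gt)

------------------------------------------------------------------------
count : {P : Pred (Fin n) 0ℓ} → Decidable P → ℕ
count P? = sumℕ (λ i → if does (P? i) then 1 else 0)

-- The Lehmer code of π: entry i is #{ j > i : π(j) < π(i) }, so that π(i) is
-- the (lehmer π i + 1)-th smallest value not among π(0), …, π(i-1).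
lehmer : Permutation′ n → Fin n → ℕ
lehmer π i = count (λ j → (i Fin.<? j) ×-dec ((π ⟨$⟩ʳ j) Fin.<? (π ⟨$⟩ʳ i)))

inversions : Permutation′ n → ℕ
inversions π = sumℕ (lehmer π)

-- The exponents k < n suffice, since cycles have length at most n.
SameCycle : Permutation′ n → Rel (Fin n) 0ℓ
SameCycle {n} π i j = ∃[ k ] fold i (π ⟨$⟩ʳ_) (toℕ {n} k) ≡ j

sameCycle? : (π : Permutation′ n) → ∀ i j → Dec (SameCycle π i j)
sameCycle? π i j = Fin.any? (λ k → fold i (π ⟨$⟩ʳ_) (toℕ k) Fin.≟ j)

-- deduplicate keeps exactly one element of each cycle (fixed points included).
cyc : Permutation′ n → ℕ
cyc {n} π = length (deduplicate (sameCycle? π) (allFin n))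

indicator-cong : ∀ {P Q : Set} (P? : Dec P) (Q? : Dec Q) → (P → Q) → (Q → P) →
                 (if does P? then 1 else 0) ≡ (if does Q? then 1 else 0)
indicator-cong (yes _) (yes _) _ _ = refl
indicator-cong (no _)  (no _)  _ _ = refl
indicator-cong (yes p) (no ¬q) f _ = contradiction (f p) ¬q
indicator-cong (no ¬p) (yes q) _ g = contradiction (g q) ¬p

indicator≤1 : ∀ {P : Set} (P? : Dec P) → (if does P? then 1 else 0) ℕ.≤ 1
indicator≤1 (yes _) = s≤s z≤n
indicator≤1 (no _)  = z≤n

indicator-no : ∀ {P : Set} (P? : Dec P) → ¬ P → (if does P? then 1 else 0) ≡ 0
indicator-no (yes p) ¬p = contradiction p ¬p
indicator-no (no _)  _  = refl

count-cong : {P Q : Pred (Fin n) 0ℓ} (P? : Decidable P) (Q? : Decidable Q) →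
             (∀ i → P i → Q i) → (∀ i → Q i → P i) → count P? ≡ count Q?
count-cong {zero}  P? Q? f g = refl
count-cong {suc n} P? Q? f g =
  cong₂ ℕ._+_ (indicator-cong (P? zero) (Q? zero) (f zero) (g zero))
              (count-cong (P? ∘ suc) (Q? ∘ suc) (f ∘ suc) (g ∘ suc))

count≤n : {P : Pred (Fin n) 0ℓ} (P? : Decidable P) → count P? ℕ.≤ n
count≤n {zero}  P? = z≤n
count≤n {suc n} P? = ℕ.+-mono-≤ (indicator≤1 (P? zero)) (count≤n (P? ∘ suc))

count-above : {P : Pred (Fin n) 0ℓ} (P? : Decidable P) (k : Fin n) →
              (∀ j → P j → k Fin.< j) → count P? ℕ.+ toℕ k ℕ.< n
count-above {suc n} P? k above rewrite indicator-no (P? zero) (λ p → ℕ.n≮0 (above zero p)) with k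
... | zero   = s≤s (subst (ℕ._≤ n) (sym (ℕ.+-identityʳ _)) (count≤n (P? ∘ suc)))
... | suc k′ = s≤s (subst (ℕ._≤ n) (sym (ℕ.+-suc _ (toℕ k′)))
                 (count-above (P? ∘ suc) k′ (λ j p → ℕ.s≤s⁻¹ (above (suc j) p))))

minimum : (_≺_ : Rel (Fin (suc n)) 0ℓ) → Transitive _≺_ → (∀ {i j} → i ≢ j → i ≺ j ⊎ j ≺ i) →
          ∃[ k ] ∀ j → j ≢ k → k ≺ j
minimum {zero}  _≺_ tr tot = zero , λ { zero 0≢0 → contradiction refl 0≢0 }
minimum {suc n} _≺_ tr tot
  with minimum (λ i j → suc i ≺ suc j) tr (λ i≢j → tot (i≢j ∘ Fin.suc-injective))
... | k , least with tot {zero} {suc k} (λ ())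
... | inj₁ 0≺k = zero , low
  where
  low : ∀ j → j ≢ zero → zero ≺ j
  low zero    0≢0 = contradiction refl 0≢0
  low (suc j) _ with j Fin.≟ k
  ... | yes refl = 0≺k
  ... | no j≢k   = tr 0≺k (least j j≢k)
... | inj₂ k≺0 = suc k , low
  where
  low : ∀ j → j ≢ suc k → suc k ≺ j
  low zero    _   = k≺0
  low (suc j) j≢k = least j (j≢k ∘ cong suc)

sort : (_≺_ : Rel (Fin n) 0ℓ) → Transitive _≺_ → (∀ {i j} → i ≢ j → i ≺ j ⊎ j ≺ i) →
       Σ[ π ∈ Permutation′ n ] (∀ {i j} → i Fin.< j → (π ⟨$⟩ʳ i) ≺ (π ⟨$⟩ʳ j))
sort {zero}  _≺_ tr tot = idₚ , λ { {()} }
sort {suc n} _≺_ tr tot with minimum _≺_ tr tot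
... | k , least with sort (λ i j → punchIn k i ≺ punchIn k j) tr
                          (λ i≢j → tot (i≢j ∘ Fin.punchIn-injective k _ _))
... | π , sorted = insert zero k π , sorted′
  where
  sorted′ : ∀ {i j} → i Fin.< j → (insert zero k π ⟨$⟩ʳ i) ≺ (insert zero k π ⟨$⟩ʳ j)
  sorted′ {zero}  {suc j} _   = least (punchIn k (π ⟨$⟩ʳ j)) (Fin.punchInᵢ≢i k _)
  sorted′ {suc i} {suc j} i<j = sorted (ℕ.s≤s⁻¹ i<j)

count-permute : {P : Pred (Fin n) 0ℓ} (P? : Decidable P) (π : Permutation′ n) →
                count (λ i → P? (π ⟨$⟩ʳ i)) ≡ count P?
count-permute P? π = sym (sumℕ-permute (λ i → if does (P? i) then 1 else 0) π)

punchIn-mono : (k : Fin (suc n)) {i j : Fin n} → i Fin.< j → punchIn k i Fin.< punchIn k j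
punchIn-mono zero    i<j = s≤s i<j
punchIn-mono (suc k) {zero}  {suc j} i<j = s≤s z≤n
punchIn-mono (suc k) {suc i} {suc j} i<j = s≤s (punchIn-mono k (ℕ.s≤s⁻¹ i<j))

punchIn-cancel : (k : Fin (suc n)) {i j : Fin n} → punchIn k i Fin.< punchIn k j → i Fin.< j
punchIn-cancel zero    i<j = ℕ.s≤s⁻¹ i<j
punchIn-cancel (suc k) {zero}  {suc j} i<j = s≤s z≤n
punchIn-cancel (suc k) {suc i} {suc j} i<j = s≤s (punchIn-cancel k (ℕ.s≤s⁻¹ i<j))

count-none : {P : Pred (Fin n) 0ℓ} (P? : Decidable P) → (∀ i → ¬ P i) → count P? ≡ 0
count-none {zero}  P? none = refl
count-none {suc n} P? none =
  cong₂ ℕ._+_ (indicator-no (P? zero) (none zero)) (count-none (P? ∘ suc) (none ∘ suc))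

count-below : (k : Fin (suc n)) → count (λ (j : Fin n) → punchIn k j Fin.<? k) ≡ toℕ k
count-below {n} zero = count-none (λ (j : Fin n) → suc j Fin.<? zero {n}) (λ _ ())
count-below {suc n} (suc k) =
  cong suc (trans (count-cong (λ j → punchIn (suc k) (suc j) Fin.<? suc k) (λ j → punchIn k j Fin.<? k)
                     (λ _ → ℕ.s≤s⁻¹) (λ _ → s≤s))
                  (count-below k))

decode : (c : Fin n → ℕ) → (∀ i → c i ℕ.+ toℕ i ℕ.< n) →
         Σ[ π ∈ Permutation′ n ] (∀ i → lehmer π i ≡ c i)
decode {zero}  c bound = idₚ , λ ()
decode {suc n} c bound with decode (c ∘ suc)
  (λ i → ℕ.s≤s⁻¹ (subst (ℕ._< suc n) (ℕ.+-suc (c (suc i)) (toℕ i)) (bound (suc i))))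
... | π , code = ρ , code′
  where
  c₀<n : c zero ℕ.< suc n
  c₀<n = subst (ℕ._< suc n) (ℕ.+-identityʳ (c zero)) (bound zero)
  k = Fin.fromℕ< c₀<n
  ρ = insert zero k π
  code′ : ∀ i → lehmer ρ i ≡ c i
  code′ zero = trans
    (trans (count-cong (λ j → (zero {n} Fin.<? suc j) ×-dec (punchIn k (π ⟨$⟩ʳ j) Fin.<? k))
                       (λ j → punchIn k (π ⟨$⟩ʳ j) Fin.<? k)
                       (λ _ → proj₂) (λ _ lt → s≤s z≤n , lt))
           (count-permute (λ j → punchIn k j Fin.<? k) π))
    (trans (count-below k) (Fin.toℕ-fromℕ< c₀<n))
  code′ (suc i) = trans
    (count-cong (λ j → (suc i Fin.<? suc j) ×-dec (punchIn k (π ⟨$⟩ʳ j) Fin.<? punchIn k (π ⟨$⟩ʳ i)))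
                (λ j → (i Fin.<? j) ×-dec ((π ⟨$⟩ʳ j) Fin.<? (π ⟨$⟩ʳ i)))
                (λ { _ (lt , lt′) → ℕ.s≤s⁻¹ lt , punchIn-cancel k lt′ })
                (λ { _ (lt , lt′) → s≤s lt , punchIn-mono k lt′ }))
    (code i)

------------------------------------------------------------------------
-- The map f(A) = (σ A , τ A).  Each component comes with its defining
-- property, for every point B of the component of A.

above? : (A : Region m) (i : Fin m) →
         Decidable (λ (j : Fin (suc m)) → inject₁ i Fin.< j × x A (inject₁ i) -ℝ x A j <ℝ y A i)
above? A i j with inject₁ i Fin.<? j
... | no  i≮j = no (i≮j ∘ proj₁)
... | yes i<j with #⇒dec (proj₂ (Region.off A) i<j)
...   | yes lt = yes (i<j , lt)
...   | no ¬lt = no (¬lt ∘ proj₂)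

ℓᵢ : Region m → Fin m → ℕ
ℓᵢ A i = count (above? A i)

x-continuous : ∀ m (i : Fin (suc m)) → Continuous (λ p → xᶜ m p i)
x-continuous m i = coord-continuous (i ↑ˡ m)

ℓᵢ-cong : {A B : Region m} → A ∼ B → ∀ i → ℓᵢ A i ≡ ℓᵢ B i
ℓᵢ-cong {m} {A} {B} A∼B i = count-cong (above? A i) (above? B i) (move {A} {B} A∼B) (move {B} {A} (joined-sym A∼B))
  where
  move : {A B : Region m} → A ∼ B → ∀ j →
         inject₁ i Fin.< j × x A (inject₁ i) -ℝ x A j <ℝ y A i →
         inject₁ i Fin.< j × x B (inject₁ i) -ℝ x B j <ℝ y B i
  move A∼B j (i<j , lt) = i<j ,
    same-side {F = λ p → xᶜ m p (inject₁ i) -ℝ xᶜ m p j} {G = λ p → yᶜ m p i}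
      (sub-continuous {F = λ p → xᶜ m p (inject₁ i)} {G = λ p → xᶜ m p j}
         (x-continuous m (inject₁ i)) (x-continuous m j))
      (coord-continuous (suc m ↑ʳ i)) (λ off → proj₂ off i<j) A∼B lt

injective : (π : Permutation′ n) → ∀ {i j} → π ⟨$⟩ʳ i ≡ π ⟨$⟩ʳ j → i ≡ j
injective π eq = trans (sym (inverseˡ π)) (trans (cong (Inverse.from π) eq) (inverseˡ π))

σ-exists : (A : Region m) → Σ[ σ ∈ Permutation′ (suc m) ]
           (∀ B → B ∼ A → ∀ {i j} → i Fin.< j → x B (σ ⟨$⟩ʳ i) <ℝ x B (σ ⟨$⟩ʳ j))
σ-exists {m} A with sort (λ i j → x A i <ℝ x A j)
                         <ℝ-trans
                         (off⇒# (Region.point A) (Region.off A))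
... | σ , sorted = σ , λ B B∼A {i} {j} i<j →
  same-side {F = λ p → xᶜ m p (σ ⟨$⟩ʳ i)} {G = λ p → xᶜ m p (σ ⟨$⟩ʳ j)}
    (x-continuous m (σ ⟨$⟩ʳ i)) (x-continuous m (σ ⟨$⟩ʳ j))
    (λ {z} off → off⇒# z off (λ eq → Fin.<⇒≢ i<j (injective σ eq)))
    (joined-sym B∼A) (sorted i<j)

τ-exists : (A : Region m) → Σ[ τ ∈ Permutation′ (suc m) ]
           (∀ B → B ∼ A → (∀ i → lehmer τ (inject₁ i) ≡ ℓᵢ B i) × lehmer τ (fromℕ m) ≡ 0)
τ-exists {m} A = proj₁ decoded , λ B B∼A →
  (λ i → trans (proj₂ decoded (inject₁ i)) (trans (code-inject₁ i) (ℓᵢ-cong {m} {A} {B} (joined-sym B∼A) i))) ,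
  trans (proj₂ decoded (fromℕ m)) code-fromℕ
  where
  code : Fin (suc m) → ℕ
  code i with view i
  ... | ‵fromℕ     = 0
  ... | ‵inject₁ j = ℓᵢ A j

  code-inject₁ : ∀ j → code (inject₁ j) ≡ ℓᵢ A j
  code-inject₁ j rewrite view-inject₁ j = refl

  code-fromℕ : code (fromℕ m) ≡ 0
  code-fromℕ rewrite view-fromℕ m = refl

  bound : ∀ i → code i ℕ.+ toℕ i ℕ.< suc m
  bound i with view i
  ... | ‵fromℕ     = Fin.toℕ<n (fromℕ m)
  ... | ‵inject₁ j = count-above (above? A j) (inject₁ j) (λ _ → proj₁)

  decoded = decode code bound

σ τ : Region m → Permutation′ (suc m)
σ A = proj₁ (σ-exists A)
τ A = proj₁ (τ-exists A)

------------------------------------------------------------------------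
Enumeration : ∀ {a ℓ} → Setoid a ℓ → Set (a ⊔ ℓ)
Enumeration S = ∃[ N ] Inverse (setoid (Fin N)) S

-- K and its element t are arbitrary in the weights below; for K = ℤ[t] an
-- equation between them is an identity of polynomials.
module Weights {c ℓ} (K : CommutativeRing c ℓ) where
  open CommutativeRing K using (1#; -_; semiring; +-commutativeMonoid; *-commutativeMonoid)
  open CommutativeRing K public using (Carrier; _≈_; _*_; _-_)
  open Exp semiring using (_^_) public
  open Mult semiring using () renaming (_×_ to _×ₙ_)

  sgn : Permutation′ n → Carrier
  sgn π = (- 1#) ^ inversions π

  ε : Region m → Carrier
  ε A = sgn (σ A) * sgn (τ A)

  ι : ℕ → Carrier
  ι k = k ×ₙ 1#

  sumOver : ∀ {a ℓ′} {S : Setoid a ℓ′} → Enumeration S → (Setoid.Carrier S → Carrier) → Carrier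
  sumOver (N , e) g = Sum.sum +-commutativeMonoid (λ k → g (Inverse.to e k))

  infix 5 sumOver
  syntax sumOver E (λ A → v) = ∑[ A ∈ E ] v

  ∏₁ : ∀ k → (ℕ → Carrier) → Carrier
  ∏₁ k g = Sum.sum *-commutativeMonoid (λ (i : Fin k) → g (suc (toℕ i)))

  infix 8 ∏₁
  syntax ∏₁ k (λ i → v) = ∏[1≤ i ≤ k ] v

{-# OPTIONS --safe #-}
-- A region is determined by the signs of the linear forms cutting it out, that
-- is, by the order of the xᵢ together with, for each i, the number of j > i
-- with yᵢ > xᵢ - xⱼ; all pairs (σ , τ) occur, so the sum factors as
--   t · (Σ_π sgn π · t^(cyc π - 1))².
-- For the inner sum, write a permutation of {0, …, n} uniquely as (0 k) ∘ π
-- with π fixing 0.  The choice k = 0 adds a cycle; each of the n others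
-- inserts 0 into the cycle of k and changes the sign.  So every step
-- multiplies the sum by t - n.
module Submission where

open import Defs
open import Level using (0ℓ)
open import Algebra.Bundles using (CommutativeMonoid; CommutativeRing)
import Algebra.Properties.CommutativeMonoid.Sum as Sum
import Algebra.Properties.CommutativeSemigroup as CommutativeSemigroup
import Algebra.Properties.Ring as RingProperties
import Algebra.Properties.Semiring.Exp as Exp
import Algebra.Properties.Semiring.Sum as SemiringSum
open import Data.Bool.Base using (Bool; true; false; not; _∧_; if_then_else_)
open import Data.Fin.Base as Fin
  using (Fin; zero; suc; toℕ; fromℕ; fromℕ<; inject₁; punchIn; splitAt; _↑ˡ_; _↑ʳ_; combine; remQuot)
import Data.Fin.Properties as Fin
open import Data.Fin.Permutation as Perm
  using (Permutation′; _⟨$⟩ʳ_; _⟨$⟩ˡ_; _∘ₚ_; flip; remove; lift₀; transpose;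
         inverseˡ; inverseʳ; punchIn-permute; lift₀-remove)
  renaming (id to idₚ; _≈_ to _≈ₚ_)
import Data.Fin.Permutation.Components as PC
open import Data.Fin.Relation.Unary.Top using (view; ‵fromℕ; ‵inject₁)
import Data.Integer.Base as ℤ
import Data.Integer.Properties as ℤ
open import Data.List.Base using (List; []; _∷_; length; map; filter; deduplicate; allFin)
import Data.List.Properties as List
open import Data.List.Membership.Propositional using (lose; find)
open import Data.List.Membership.Propositional.Properties using (∈-filter⁺; ∈-allFin)
open import Data.List.Relation.Unary.All as All using (All; []; _∷_)
import Data.List.Relation.Unary.All.Properties as All
open import Data.List.Relation.Unary.AllPairs using (AllPairs; []; _∷_)
import Data.List.Relation.Unary.AllPairs.Properties as AllPairs
open import Data.List.Relation.Unary.Any using (Any; here; there)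
open import Data.Nat.Base as ℕ using (ℕ; zero; suc; _∸_; s≤s; z≤n)
import Data.Nat.Coprimality as ℕ
import Data.Nat.DivMod as ℕ
open import Data.Nat.GeneralisedArithmetic using (fold; fold-+)
import Data.Nat.Properties as ℕ
open import Data.Product using (∃-syntax; _×_; _,_; proj₁; proj₂; uncurry)
open import Data.Product.Relation.Binary.Pointwise.NonDependent using (×-setoid)
open import Data.Rational.Base as ℚ using (ℚ; 0ℚ; ½; 1ℚ)
import Data.Rational.Properties as ℚ
open import Data.Rational.Solver using (module +-*-Solver)
import Data.Rational.Unnormalised.Base as ℚᵘ
import Data.Rational.Unnormalised.Properties as ℚᵘ
open import Data.Sum.Base using (_⊎_; inj₁; inj₂; [_,_]′)
open import Function.Base using (_∘_; id)
open import Function.Bundles using (Inverse)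
import Function.Consequences.Setoid as Consequences
import Function.Construct.Composition as Composition
import Function.Construct.Identity as Identity
import Function.Construct.Symmetry as Symmetry
open import Relation.Binary.Bundles using (Setoid)
open import Relation.Binary.Core using (Rel)
open import Relation.Binary.Definitions using (Tri; tri<; tri≈; tri>)
open import Relation.Binary.PropositionalEquality
import Relation.Binary.Reasoning.Setoid as SetoidReasoning
open import Relation.Nullary using (¬_; Dec; yes; no; does; contradiction; ¬?; _×-dec_)
open import Relation.Nullary.Decidable using (dec-true; dec-false)
open import Relation.Unary using (Pred; Decidable; _⊆_; _∪_)

open Sum ℕ.+-0-commutativeMonoid using (∑-distrib-+; ∑-comm)
  renaming (sum to sumℕ; sum-permute to sumℕ-permute; sum-cong-≗ to sumℕ-cong)
open ℝ

-- The signs of the linear forms cut out a convex set, but that convex sets are connected has to be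
-- shown for Cauchy sequences, and for open sets that need not respect equality of reals. Two points
-- are therefore joined by a segment whose parameter is a real weight; bisection, driven by the
-- cover alone, finds a limit point on it, and openness moves membership between sequences that
-- agree termwise. Comparisons of reals are decided only where apartness from the hyperplanes
-- decides them.
--
-- The sizes ℓᵢ suffice because yᵢ > xᵢ - xⱼ says xⱼ > xᵢ - yᵢ: the j in question are the last ones
-- among the j > i in the order of the xⱼ, and a final segment of a given order is known from its
-- size. Conversely, a suitable cut reaches every admissible size.
--
-- The sign is defined by inversions, so its multiplicativity comes from counting pairs. Cycles are
-- counted by the representatives that `deduplicate` keeps; zero, the head of the list, is always
-- one of them, which fits an induction that adds zero.

private
  variable
    d m n : ℕ

-- Lehmer codes

lehmer-cong : {π ρ : Permutation′ n} → π ≈ₚ ρ → ∀ i → lehmer π i ≡ lehmer ρ i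
lehmer-cong {π = π} {ρ} π≈ρ i =
  count-cong (λ j → (i Fin.<? j) ×-dec ((π ⟨$⟩ʳ j) Fin.<? (π ⟨$⟩ʳ i)))
             (λ j → (i Fin.<? j) ×-dec ((ρ ⟨$⟩ʳ j) Fin.<? (ρ ⟨$⟩ʳ i)))
    (λ { j (i<j , lt) → i<j , subst₂ Fin._<_ (π≈ρ j) (π≈ρ i) lt })
    (λ { j (i<j , lt) → i<j , subst₂ Fin._<_ (sym (π≈ρ j)) (sym (π≈ρ i)) lt })

-- All values other than π(0) occur at later places, so every value below π(0) is counted.
lehmer-zero : (π : Permutation′ (suc n)) → lehmer π zero ≡ toℕ (π ⟨$⟩ʳ zero)
lehmer-zero {n} π = trans
  (trans (count-cong (λ j → (zero {n} Fin.<? suc j) ×-dec ((π ⟨$⟩ʳ suc j) Fin.<? k))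
                     (λ j → punchIn k (remove zero π ⟨$⟩ʳ j) Fin.<? k)
                     (λ { j (_ , lt) → subst (Fin._< k) (punchIn-permute π zero j) lt })
                     (λ j lt → s≤s z≤n , subst (Fin._< k) (sym (punchIn-permute π zero j)) lt))
         (count-permute (λ j → punchIn k j Fin.<? k) (remove zero π)))
  (count-below k)
  where
  k = π ⟨$⟩ʳ zero

-- `punchIn k` is monotone, so deleting place 0 together with its value k leaves all comparisons
-- between later places as they were.
lehmer-suc : (π : Permutation′ (suc n)) → ∀ i → lehmer π (suc i) ≡ lehmer (remove zero π) i
lehmer-suc π i =
  count-cong (λ j → (suc i Fin.<? suc j) ×-dec ((π ⟨$⟩ʳ suc j) Fin.<? (π ⟨$⟩ʳ suc i)))
             (λ j → (i Fin.<? j) ×-dec ((remove zero π ⟨$⟩ʳ j) Fin.<? (remove zero π ⟨$⟩ʳ i)))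
    (λ { j (i<j , lt) → ℕ.s≤s⁻¹ i<j ,
         punchIn-cancel k (subst₂ Fin._<_ (punchIn-permute π zero j) (punchIn-permute π zero i) lt) })
    (λ { j (i<j , lt) → s≤s i<j ,
         subst₂ Fin._<_ (sym (punchIn-permute π zero j)) (sym (punchIn-permute π zero i)) (punchIn-mono k lt) })
  where
  k = π ⟨$⟩ʳ zero

lehmer-injective : (π ρ : Permutation′ n) → (∀ i → lehmer π i ≡ lehmer ρ i) → π ≈ₚ ρ
lehmer-injective {suc n} π ρ eq = go
  where
  zero-eq : π ⟨$⟩ʳ zero ≡ ρ ⟨$⟩ʳ zero
  zero-eq = Fin.toℕ-injective (trans (sym (lehmer-zero π)) (trans (eq zero) (lehmer-zero ρ)))
  suc-eq : remove zero π ≈ₚ remove zero ρ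
  suc-eq = lehmer-injective (remove zero π) (remove zero ρ)
    (λ i → trans (sym (lehmer-suc π i)) (trans (eq (suc i)) (lehmer-suc ρ i)))
  go : π ≈ₚ ρ
  go zero    = zero-eq
  go (suc i) = trans (punchIn-permute π zero i)
    (trans (cong₂ punchIn zero-eq (suc-eq i)) (sym (punchIn-permute ρ zero i)))

lehmer-increasing : (π : Permutation′ n) → (∀ {i j} → i Fin.< j → π ⟨$⟩ʳ i Fin.< π ⟨$⟩ʳ j) → ∀ i → lehmer π i ≡ 0
lehmer-increasing π mono i =
  count-none (λ j → (i Fin.<? j) ×-dec ((π ⟨$⟩ʳ j) Fin.<? (π ⟨$⟩ʳ i)))
    λ { j (i<j , lt) → ℕ.<-asym lt (mono i<j) }

-- The permutation ρ⁻¹π is increasing; its code vanishes like that of the identity, and the code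
-- determines the permutation.
sorted-unique : (_≺_ : Rel (Fin n) 0ℓ) → (∀ {i j} → i ≺ j → ¬ (j ≺ i)) → (π ρ : Permutation′ n) →
  (∀ {i j} → i Fin.< j → (π ⟨$⟩ʳ i) ≺ (π ⟨$⟩ʳ j)) → (∀ {i j} → i Fin.< j → (ρ ⟨$⟩ʳ i) ≺ (ρ ⟨$⟩ʳ j)) → π ≈ₚ ρ
sorted-unique {n} _≺_ asym π ρ sπ sρ i = trans (sym (ρθ i)) (cong (ρ ⟨$⟩ʳ_) (θ≈id i))
  where
  θ : Permutation′ n
  θ = π ∘ₚ flip ρ
  ρθ : ∀ i → ρ ⟨$⟩ʳ (θ ⟨$⟩ʳ i) ≡ π ⟨$⟩ʳ i
  ρθ i = inverseʳ ρ
  mono : ∀ {i j} → i Fin.< j → θ ⟨$⟩ʳ i Fin.< θ ⟨$⟩ʳ j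
  mono {i} {j} i<j with Fin.<-cmp (θ ⟨$⟩ʳ i) (θ ⟨$⟩ʳ j)
  ... | tri< lt _ _ = lt
  ... | tri≈ _ eq _ = contradiction (injective θ eq) (Fin.<⇒≢ i<j)
  ... | tri> _ _ gt = contradiction (subst₂ _≺_ (ρθ j) (ρθ i) (sρ gt)) (asym (sπ i<j))
  θ≈id : θ ≈ₚ idₚ
  θ≈id = lehmer-injective θ idₚ λ i →
    trans (lehmer-increasing θ mono i) (sym (lehmer-increasing idₚ id i))

-- Parity of the number of inversions

private
  ind : Bool → ℕ
  ind b = if b then 1 else 0

  less : Fin n → Fin n → Bool
  less i j = does (i Fin.<? j)

  -- Equals 1 if π reverses the order of i and j, and 0 otherwise: at most one summand is nonzero,
  -- and exchanging i and j swaps the two.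
  disorder : Permutation′ n → Fin n → Fin n → ℕ
  disorder π i j = ind (less i j ∧ less (π ⟨$⟩ʳ j) (π ⟨$⟩ʳ i)) ℕ.+ ind (less j i ∧ less (π ⟨$⟩ʳ i) (π ⟨$⟩ʳ j))

  less-irrefl : ∀ (i : Fin n) → less i i ≡ false
  less-irrefl i = dec-false (i Fin.<? i) (ℕ.<-irrefl refl)

  less-flip : ∀ {i j : Fin n} → i ≢ j → less j i ≡ not (less i j)
  less-flip {i = i} {j} i≢j with Fin.<-cmp i j
  ... | tri< l _ ¬g rewrite dec-true (i Fin.<? j) l | dec-false (j Fin.<? i) ¬g = refl
  ... | tri≈ _ eq _ = contradiction eq i≢j
  ... | tri> ¬l _ g rewrite dec-false (i Fin.<? j) ¬l | dec-true (j Fin.<? i) g = refl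

  -- With a = p xor q and b = q xor r, p xor r is a xor b, which for the numbers 0 and 1 is a + b -
  -- 2ab. The bits stand for the order of a pair before π, after π and after ρ.
  xor-cocycle : ∀ p q r →
    (ind (p ∧ not r) ℕ.+ ind (not p ∧ r))
      ℕ.+ 2 ℕ.* ((ind (p ∧ not q) ℕ.+ ind (not p ∧ q)) ℕ.* (ind (q ∧ not r) ℕ.+ ind (not q ∧ r)))
    ≡ (ind (p ∧ not q) ℕ.+ ind (not p ∧ q)) ℕ.+ (ind (q ∧ not r) ℕ.+ ind (not q ∧ r))
  xor-cocycle false false false = refl
  xor-cocycle false false true  = refl
  xor-cocycle false true  false = refl
  xor-cocycle false true  true  = refl
  xor-cocycle true  false false = refl
  xor-cocycle true  false true  = refl
  xor-cocycle true  true  false = refl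
  xor-cocycle true  true  true  = refl

  disorder-∘ : (π ρ : Permutation′ n) → ∀ i j →
    disorder (π ∘ₚ ρ) i j ℕ.+ 2 ℕ.* (disorder π i j ℕ.* disorder ρ (π ⟨$⟩ʳ i) (π ⟨$⟩ʳ j))
    ≡ disorder π i j ℕ.+ disorder ρ (π ⟨$⟩ʳ i) (π ⟨$⟩ʳ j)
  disorder-∘ π ρ i j with i Fin.≟ j
  ... | yes refl rewrite less-irrefl i | less-irrefl (π ⟨$⟩ʳ i) = refl
  ... | no i≢j rewrite less-flip i≢j | less-flip (i≢j ∘ injective π) | less-flip (i≢j ∘ injective π ∘ injective ρ) =
    xor-cocycle (less i j) (less (π ⟨$⟩ʳ i) (π ⟨$⟩ʳ j)) (less (ρ ⟨$⟩ʳ (π ⟨$⟩ʳ i)) (ρ ⟨$⟩ʳ (π ⟨$⟩ʳ j)))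

  sum² : (Fin n → Fin n → ℕ) → ℕ
  sum² f = sumℕ (λ i → sumℕ (f i))

  sum²-cong : {f g : Fin n → Fin n → ℕ} → (∀ i j → f i j ≡ g i j) → sum² f ≡ sum² g
  sum²-cong eq = sumℕ-cong (λ i → sumℕ-cong (eq i))

  sum²-+ : (f g : Fin n → Fin n → ℕ) → sum² (λ i j → f i j ℕ.+ g i j) ≡ sum² f ℕ.+ sum² g
  sum²-+ f g = trans (sumℕ-cong (λ i → ∑-distrib-+ (f i) (g i))) (∑-distrib-+ (λ i → sumℕ (f i)) (λ i → sumℕ (g i)))

  sum²-sym : (f : Fin n → Fin n → ℕ) → sum² (λ i j → f i j ℕ.+ f j i) ≡ 2 ℕ.* sum² f
  sum²-sym f = trans (sum²-+ f (λ i j → f j i))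
    (cong (sum² f ℕ.+_) (trans (∑-comm (λ i j → f j i)) (sym (ℕ.+-identityʳ _))))

  sum²-permute : (f : Fin n → Fin n → ℕ) (π : Permutation′ n) →
                 sum² (λ i j → f (π ⟨$⟩ʳ i) (π ⟨$⟩ʳ j)) ≡ sum² f
  sum²-permute f π = sym (trans (sumℕ-permute (λ i → sumℕ (f i)) π)
    (sumℕ-cong (λ i → sumℕ-permute (f (π ⟨$⟩ʳ i)) π)))

-- A sum over all ordered pairs (i , j) counts every inversion twice, but unlike
-- the sum over i < j it may be reindexed along π.
inversions-∘ : (π ρ : Permutation′ n) →
               ∃[ c ] inversions (π ∘ₚ ρ) ℕ.+ 2 ℕ.* c ≡ inversions π ℕ.+ inversions ρ
-- The witness counts the pairs i < j that π reverses and ρ reverses back: they enter both inversion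
-- numbers on the right, but not that of the composite.
inversions-∘ {n} π ρ = sum² g , ℕ.*-cancelˡ-≡ _ _ 2 (begin
  2 ℕ.* (inversions (π ∘ₚ ρ) ℕ.+ 2 ℕ.* sum² g)
    ≡⟨ ℕ.*-distribˡ-+ 2 (inversions (π ∘ₚ ρ)) (2 ℕ.* sum² g) ⟩
  2 ℕ.* inversions (π ∘ₚ ρ) ℕ.+ 2 ℕ.* (2 ℕ.* sum² g)
    ≡⟨ cong₂ (λ a b → a ℕ.+ (b ℕ.+ (b ℕ.+ 0))) (sym (D≡ (π ∘ₚ ρ))) (sym (sum²-sym g)) ⟩
  sum² (disorder (π ∘ₚ ρ)) ℕ.+ 2 ℕ.* sum² (λ i j → g i j ℕ.+ g j i)
    ≡⟨ cong (λ z → sum² (disorder (π ∘ₚ ρ)) ℕ.+ 2 ℕ.* z) (sum²-cong sym-g) ⟩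
  sum² (disorder (π ∘ₚ ρ)) ℕ.+ 2 ℕ.* sum² h
    ≡⟨ cong (λ z → sum² (disorder (π ∘ₚ ρ)) ℕ.+ (sum² h ℕ.+ z)) (ℕ.+-identityʳ (sum² h)) ⟩
  sum² (disorder (π ∘ₚ ρ)) ℕ.+ (sum² h ℕ.+ sum² h)
    ≡⟨ cong (sum² (disorder (π ∘ₚ ρ)) ℕ.+_) (sym (sum²-+ h h)) ⟩
  sum² (disorder (π ∘ₚ ρ)) ℕ.+ sum² (λ i j → h i j ℕ.+ h i j)
    ≡⟨ sym (sum²-+ (disorder (π ∘ₚ ρ)) (λ i j → h i j ℕ.+ h i j)) ⟩
  sum² (λ i j → disorder (π ∘ₚ ρ) i j ℕ.+ (h i j ℕ.+ h i j))
    ≡⟨ sum²-cong (λ i j → trans (cong (λ z → disorder (π ∘ₚ ρ) i j ℕ.+ (h i j ℕ.+ z)) (sym (ℕ.+-identityʳ (h i j))))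
                                (disorder-∘ π ρ i j)) ⟩
  sum² (λ i j → disorder π i j ℕ.+ disorder ρ (π ⟨$⟩ʳ i) (π ⟨$⟩ʳ j))
    ≡⟨ sum²-+ (disorder π) _ ⟩
  sum² (disorder π) ℕ.+ sum² (λ i j → disorder ρ (π ⟨$⟩ʳ i) (π ⟨$⟩ʳ j))
    ≡⟨ cong₂ ℕ._+_ (D≡ π) (trans (sum²-permute (disorder ρ) π) (D≡ ρ)) ⟩
  2 ℕ.* inversions π ℕ.+ 2 ℕ.* inversions ρ
    ≡⟨ sym (ℕ.*-distribˡ-+ 2 (inversions π) (inversions ρ)) ⟩
  2 ℕ.* (inversions π ℕ.+ inversions ρ) ∎)
  where
  open ≡-Reasoning
  D≡ : ∀ (π : Permutation′ n) → sum² (disorder π) ≡ 2 ℕ.* inversions π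
  D≡ π = sum²-sym (λ i j → ind (less i j ∧ less (π ⟨$⟩ʳ j) (π ⟨$⟩ʳ i)))
  h g : Fin n → Fin n → ℕ
  h i j = disorder π i j ℕ.* disorder ρ (π ⟨$⟩ʳ i) (π ⟨$⟩ʳ j)
  g i j = ind (less i j ∧ less (π ⟨$⟩ʳ j) (π ⟨$⟩ʳ i)) ℕ.* disorder ρ (π ⟨$⟩ʳ i) (π ⟨$⟩ʳ j)
  sym-g : ∀ i j → g i j ℕ.+ g j i ≡ h i j
  sym-g i j = trans
    (cong (g i j ℕ.+_) (cong (ind (less j i ∧ less (π ⟨$⟩ʳ i) (π ⟨$⟩ʳ j)) ℕ.*_)
      (ℕ.+-comm (ind (less (π ⟨$⟩ʳ j) (π ⟨$⟩ʳ i) ∧ less (ρ ⟨$⟩ʳ (π ⟨$⟩ʳ i)) (ρ ⟨$⟩ʳ (π ⟨$⟩ʳ j)))) _)))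
    (sym (ℕ.*-distribʳ-+ (disorder ρ (π ⟨$⟩ʳ i) (π ⟨$⟩ʳ j)) (ind (less i j ∧ less (π ⟨$⟩ʳ j) (π ⟨$⟩ʳ i))) _))

inversions-cong : {π ρ : Permutation′ n} → π ≈ₚ ρ → inversions π ≡ inversions ρ
inversions-cong {π = π} {ρ} π≈ρ = sumℕ-cong (lehmer-cong {π = π} {ρ} π≈ρ)

inversions-lift₀ : (π : Permutation′ n) → inversions (lift₀ π) ≡ inversions π
inversions-lift₀ π = cong₂ ℕ._+_ (lehmer-zero (lift₀ π)) (sumℕ-cong λ i →
  count-cong (λ j → (suc i Fin.<? suc j) ×-dec (suc (π ⟨$⟩ʳ j) Fin.<? suc (π ⟨$⟩ʳ i)))
             (λ j → (i Fin.<? j) ×-dec ((π ⟨$⟩ʳ j) Fin.<? (π ⟨$⟩ʳ i)))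
    (λ { _ (a , b) → ℕ.s≤s⁻¹ a , ℕ.s≤s⁻¹ b }) (λ { _ (a , b) → s≤s a , s≤s b }))

-- The values read 1, 0, 2, 3, ...; past place 0 they increase, so the code is 1, 0, 0, ....
inversions-transpose₀₁ : inversions (transpose {suc (suc n)} zero (suc zero)) ≡ 1
inversions-transpose₀₁ {n} = cong₂ ℕ._+_ (lehmer-zero T)
  (trans (sumℕ-cong (λ i → trans (lehmer-suc T i) (lehmer-increasing (remove zero T) mono i))) (zeros (suc n)))
  where
  T = transpose {suc (suc n)} zero (suc zero)
  zeros : ∀ k → sumℕ {k} (λ _ → 0) ≡ 0
  zeros zero    = refl
  zeros (suc k) = zeros k
  T-mono : ∀ {i j : Fin (suc n)} → i Fin.< j → T ⟨$⟩ʳ suc i Fin.< T ⟨$⟩ʳ suc j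
  T-mono {zero}  {suc j} _   = s≤s z≤n
  T-mono {suc i} {suc j} i<j = s≤s i<j
  mono : ∀ {i j} → i Fin.< j → remove zero T ⟨$⟩ʳ i Fin.< remove zero T ⟨$⟩ʳ j
  mono {i} {j} i<j = punchIn-cancel (suc zero)
    (subst₂ Fin._<_ (punchIn-permute T zero i) (punchIn-permute T zero j) (T-mono i<j))

-- Conjugating (0 1) by (1 k+2), which fixes 0, gives (0 k+2). A conjugate has the same sign, so
-- inversions need counting for (0 1) only.
transpose-conj : (k : Fin n) → transpose zero (suc (suc k)) ≈ₚ
  (lift₀ (transpose zero (suc k)) ∘ₚ transpose zero (suc zero)) ∘ₚ lift₀ (transpose zero (suc k))
transpose-conj k zero          = refl
transpose-conj k (suc zero)    rewrite dec-true (k Fin.≟ k) refl = refl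
transpose-conj k (suc (suc j)) with does (j Fin.≟ k) in eq
... | true  = refl
... | false rewrite eq = refl

-- Orbits

-- `SameCycle` with unbounded exponents, which can be added when steps are composed; `period`
-- restores the bound.
Orbit : Permutation′ n → Rel (Fin n) 0ℓ
Orbit π i j = ∃[ k ] fold i (π ⟨$⟩ʳ_) k ≡ j

orbit-refl : (π : Permutation′ n) → ∀ {i} → Orbit π i i
orbit-refl π = 0 , refl

orbit-step : (π : Permutation′ n) → ∀ {i j} → π ⟨$⟩ʳ i ≡ j → Orbit π i j
orbit-step π eq = 1 , eq

orbit-trans : (π : Permutation′ n) → ∀ {i j k} → Orbit π i j → Orbit π j k → Orbit π i k
orbit-trans π {i} (a , refl) (b , eq) = b ℕ.+ a , trans (fold-+ i (π ⟨$⟩ʳ_) b) eq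

fold-injective : (π : Permutation′ n) → ∀ a {i j} → fold i (π ⟨$⟩ʳ_) a ≡ fold j (π ⟨$⟩ʳ_) a → i ≡ j
fold-injective π zero    eq = eq
fold-injective π (suc a) eq = fold-injective π a (injective π eq)

-- Among the n + 1 iterates with exponents 0, ..., n two agree, and injectivity cancels the smaller
-- exponent.
period : (π : Permutation′ n) → ∀ i → ∃[ p ] suc p ℕ.≤ n × fold i (π ⟨$⟩ʳ_) (suc p) ≡ i
period {n} π i with Fin.pigeonhole (ℕ.n<1+n n) (λ k → fold i (π ⟨$⟩ʳ_) (toℕ k))
... | a , b , a<b , eq = p , p<n , fold-injective π (toℕ a)
      (trans (sym (fold-+ i (π ⟨$⟩ʳ_) (toℕ a))) (trans (cong (fold i (π ⟨$⟩ʳ_)) a+p≡b) (sym eq)))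
  where
  p = toℕ b ℕ.∸ suc (toℕ a)
  a+p≡b : toℕ a ℕ.+ suc p ≡ toℕ b
  a+p≡b = trans (ℕ.+-suc (toℕ a) p) (ℕ.m+[n∸m]≡n a<b)
  p<n : suc p ℕ.≤ n
  p<n = ℕ.≤-trans (ℕ.≤-trans (ℕ.m≤n+m (suc p) (toℕ a)) (ℕ.≤-reflexive a+p≡b)) (ℕ.s≤s⁻¹ (Fin.toℕ<n b))

fold-periodic : (π : Permutation′ n) → ∀ {i p} → fold i (π ⟨$⟩ʳ_) p ≡ i → ∀ q → fold i (π ⟨$⟩ʳ_) (q ℕ.* p) ≡ i
fold-periodic π eq zero = refl
fold-periodic π {i} {p} eq (suc q) =
  trans (fold-+ i (π ⟨$⟩ʳ_) p) (trans (cong (λ z → fold z (π ⟨$⟩ʳ_) p) (fold-periodic π eq q)) eq)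

orbit-sym : (π : Permutation′ n) → ∀ {i j} → Orbit π i j → Orbit π j i
orbit-sym π {i} (k , refl) with period π i
-- k (p + 1) is a multiple of the period and at least k, so the subtraction is not truncated and
-- completes the k steps to a return to i.
... | p , _ , eq = k ℕ.* suc p ℕ.∸ k ,
  trans (sym (fold-+ i (π ⟨$⟩ʳ_) (k ℕ.* suc p ℕ.∸ k)))
    (trans (cong (fold i (π ⟨$⟩ʳ_)) (ℕ.m∸n+n≡m (ℕ.m≤m*n k (suc p)))) (fold-periodic π eq k))

-- Reducing the exponent modulo the period, which is at most n, brings it into `Fin n`.
orbit⇒sameCycle : (π : Permutation′ n) → ∀ {i j} → Orbit π i j → SameCycle π i j
orbit⇒sameCycle {n} π {i} {j} (k , eq) with period π i
... | p , p<n , per = fromℕ< r<n , trans (cong (fold i (π ⟨$⟩ʳ_)) (Fin.toℕ-fromℕ< r<n)) (trans (sym red) eq)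
  where
  r<n : k ℕ.% suc p ℕ.< n
  r<n = ℕ.<-≤-trans (ℕ.m%n<n k (suc p)) p<n
  red : fold i (π ⟨$⟩ʳ_) k ≡ fold i (π ⟨$⟩ʳ_) (k ℕ.% suc p)
  red = trans (cong (fold i (π ⟨$⟩ʳ_)) (ℕ.m≡m%n+[m/n]*n k (suc p)))
    (trans (fold-+ i (π ⟨$⟩ʳ_) (k ℕ.% suc p))
      (cong (λ z → fold z (π ⟨$⟩ʳ_) (k ℕ.% suc p)) (fold-periodic π per (k ℕ./ suc p))))

sameCycle⇒orbit : (π : Permutation′ n) → ∀ {i j} → SameCycle π i j → Orbit π i j
sameCycle⇒orbit π (k , eq) = toℕ k , eq

sameCycle-⇔ : (π : Permutation′ m) (ρ : Permutation′ n) → ∀ {i j i′ j′} →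
  (Orbit π i j → Orbit ρ i′ j′) → SameCycle π i j → SameCycle ρ i′ j′
sameCycle-⇔ π ρ f = orbit⇒sameCycle ρ ∘ f ∘ sameCycle⇒orbit π

-- Representatives of equivalence classes in a list

module _ {A B : Set} {P : Pred A 0ℓ} {Q : Pred B 0ℓ} (P? : Decidable P) (Q? : Decidable Q) (f : A → B)
         (to : ∀ x → P x → Q (f x)) (from : ∀ x → Q (f x) → P x) where

  filter-map-commute : ∀ xs → filter Q? (map f xs) ≡ map f (filter P? xs)
  filter-map-commute [] = refl
  filter-map-commute (x ∷ xs) with P? x | Q? (f x)
  ... | yes _ | yes _ = cong (f x ∷_) (filter-map-commute xs)
  ... | no _  | no _  = filter-map-commute xs
  ... | yes p | no ¬q = contradiction (to x p) ¬q
  ... | no ¬p | yes q = contradiction (from x q) ¬p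

module _ {A B : Set} {R : Rel A 0ℓ} {S : Rel B 0ℓ} (R? : ∀ x y → Dec (R x y)) (S? : ∀ x y → Dec (S x y))
         (f : A → B) (to : ∀ x y → R x y → S (f x) (f y)) (from : ∀ x y → S (f x) (f y) → R x y) where

  deduplicate-map : ∀ xs → deduplicate S? (map f xs) ≡ map f (deduplicate R? xs)
  deduplicate-map [] = refl
  deduplicate-map (x ∷ xs) = cong (f x ∷_) (trans
    (cong (filter (¬? ∘ S? (f x))) (deduplicate-map xs))
    (filter-map-commute (¬? ∘ R? x) (¬? ∘ S? (f x)) f (λ y → _∘ from x y) (λ y → _∘ to x y) (deduplicate R? xs)))

module _ {A : Set} {R : Rel A 0ℓ} (R? : ∀ x y → Dec (R x y))
         (R-sym : ∀ {x y} → R x y → R y x) (R-trans : ∀ {x y z} → R x y → R y z → R x z) where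

  private
    D : List A → List A
    D = deduplicate R?

  deduplicate-distinct : ∀ xs → AllPairs (λ x y → ¬ R x y) (D xs)
  deduplicate-distinct []       = []
  deduplicate-distinct (x ∷ xs) =
    All.all-filter (¬? ∘ R? x) (D xs) ∷ AllPairs.filter⁺ (¬? ∘ R? x) (deduplicate-distinct xs)

  deduplicate-represents : ∀ {k} xs → Any (R k) xs → Any (R k) (D xs)
  deduplicate-represents (x ∷ xs) (here Rkx) = here Rkx
  deduplicate-represents (x ∷ xs) (there p) with find (deduplicate-represents xs p)
  ... | y , y∈ , Rky with R? x y
  -- Here x filters out y and takes its place as representative.
  ...   | yes Rxy = here (R-trans Rky (R-sym Rxy))
  ...   | no ¬Rxy = there (lose (∈-filter⁺ (¬? ∘ R? x) y∈ ¬Rxy) Rky)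

  -- Two entries related to k would be related to each other, so the filter removes exactly one
  -- entry.
  length-remove-class : ∀ {k} xs → AllPairs (λ x y → ¬ R x y) xs → Any (R k) xs →
                        suc (length (filter (¬? ∘ R? k) xs)) ≡ length xs
  length-remove-class {k} (x ∷ xs) (x≁ ∷ distinct) p with R? k x
  ... | yes Rkx = cong (suc ∘ length)
    (List.filter-all (¬? ∘ R? k) (All.map (λ ¬Rxy Rky → ¬Rxy (R-trans (R-sym Rkx) Rky)) x≁))
  ... | no ¬Rkx with p
  ...   | here Rkx = contradiction Rkx ¬Rkx
  ...   | there q  = cong suc (length-remove-class xs distinct q)

-- Number of cycles

cyc-cong : {π ρ : Permutation′ n} → π ≈ₚ ρ → cyc π ≡ cyc ρ
cyc-cong {n} {π} {ρ} π≈ρ = cong length (trans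
  -- The two relations are only equivalent; mapping along the identity compares their
  -- deduplications.
  (sym (List.map-id (deduplicate (sameCycle? π) (allFin n))))
  (trans (sym (deduplicate-map (sameCycle? π) (sameCycle? ρ) id (move π ρ π≈ρ) (move ρ π (sym ∘ π≈ρ)) (allFin n)))
         (cong (deduplicate (sameCycle? ρ)) (List.map-id (allFin n)))))
  where
  fold-cong : (π ρ : Permutation′ n) → π ≈ₚ ρ → ∀ i k → fold i (π ⟨$⟩ʳ_) k ≡ fold i (ρ ⟨$⟩ʳ_) k
  fold-cong π ρ eq i zero    = refl
  fold-cong π ρ eq i (suc k) = trans (eq _) (cong (ρ ⟨$⟩ʳ_) (fold-cong π ρ eq i k))
  move : (π ρ : Permutation′ n) → π ≈ₚ ρ → ∀ i j → SameCycle π i j → SameCycle ρ i j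
  move π ρ eq i j (k , e) = k , trans (sym (fold-cong π ρ eq i (toℕ k))) e

-- Zero heads the list and is kept; its cycle is then filtered out of the representatives of the
-- nonzero elements, whose classes are the orbits of ρ. Both extensions, with zero fixed or inserted
-- into a cycle, are counted from this form.
cyc-suc : (π : Permutation′ (suc n)) (ρ : Permutation′ n) →
  (∀ i j → Orbit ρ i j → Orbit π (suc i) (suc j)) → (∀ i j → Orbit π (suc i) (suc j) → Orbit ρ i j) →
  cyc π ≡ suc (length (filter (¬? ∘ sameCycle? π zero) (map suc (deduplicate (sameCycle? ρ) (allFin n)))))
cyc-suc {n} π ρ to from = cong (suc ∘ length ∘ filter (¬? ∘ sameCycle? π zero))
  (trans (cong (deduplicate (sameCycle? π)) (sym (List.map-tabulate id suc)))
         (deduplicate-map (sameCycle? ρ) (sameCycle? π) suc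
            (λ i j → sameCycle-⇔ ρ π (to i j)) (λ i j → sameCycle-⇔ π ρ (from i j)) (allFin n)))

cyc-lift₀ : (π : Permutation′ n) → cyc (lift₀ π) ≡ suc (cyc π)
cyc-lift₀ {n} π = trans (cyc-suc (lift₀ π) π
    (λ { i j (k , eq) → k , trans (fold-suc i k) (cong suc eq) })
    (λ { i j (k , eq) → k , Fin.suc-injective (trans (sym (fold-suc i k)) eq) }))
  (cong suc (trans
    (cong length (List.filter-all (¬? ∘ sameCycle? (lift₀ π) zero)
       (All.map⁺ (All.universal (λ { j (k , eq) → contradiction (trans (sym (fold-zero (toℕ k))) eq) λ () }) reps))))
    (List.length-map Fin.suc reps)))
  where
  reps = deduplicate (sameCycle? π) (allFin n)
  fold-zero : ∀ k → fold zero (lift₀ π ⟨$⟩ʳ_) k ≡ zero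
  fold-zero zero    = refl
  fold-zero (suc k) = cong (lift₀ π ⟨$⟩ʳ_) (fold-zero k)
  fold-suc : ∀ i k → fold (suc i) (lift₀ π ⟨$⟩ʳ_) k ≡ suc (fold i (π ⟨$⟩ʳ_) k)
  fold-suc i zero    = refl
  fold-suc i (suc k) = cong (lift₀ π ⟨$⟩ʳ_) (fold-suc i k)

-- Composing with (0 k+1) inserts 0 into the cycle of π through k.
module InsertZero (π : Permutation′ n) (k : Fin n) where

  π⁺ : Permutation′ (suc n)
  π⁺ = lift₀ π ∘ₚ transpose zero (suc k)

  -- Zero is inserted immediately before k, so identifying it with k turns each step of `π⁺` into at
  -- most one step of π.
  contract : Fin (suc n) → Fin n
  contract zero    = k
  contract (suc i) = i

  π⁺-hit : ∀ {i} → π ⟨$⟩ʳ i ≡ k → π⁺ ⟨$⟩ʳ suc i ≡ zero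
  π⁺-hit {i} eq rewrite dec-true (π ⟨$⟩ʳ i Fin.≟ k) eq = refl

  π⁺-miss : ∀ {i} → π ⟨$⟩ʳ i ≢ k → π⁺ ⟨$⟩ʳ suc i ≡ suc (π ⟨$⟩ʳ i)
  π⁺-miss {i} neq rewrite dec-false (π ⟨$⟩ʳ i Fin.≟ k) neq = refl

  contract-step : ∀ z → Orbit π (contract z) (contract (π⁺ ⟨$⟩ʳ z))
  contract-step zero    = orbit-refl π
  contract-step (suc i) = orbit-step π (choose (π ⟨$⟩ʳ i Fin.≟ k))
    where
    choose : Dec (π ⟨$⟩ʳ i ≡ k) → π ⟨$⟩ʳ i ≡ contract (π⁺ ⟨$⟩ʳ suc i)
    choose (yes eq) = trans eq (cong contract (sym (π⁺-hit eq)))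
    choose (no neq) = cong contract (sym (π⁺-miss neq))

  contract-orbit : ∀ z w → Orbit π⁺ z w → Orbit π (contract z) (contract w)
  contract-orbit z _ (zero  , refl) = orbit-refl π
  contract-orbit z _ (suc l , refl) = orbit-trans π (contract-orbit z _ (l , refl)) (contract-step (fold z (π⁺ ⟨$⟩ʳ_) l))

  expand-step : ∀ i → Orbit π⁺ (suc i) (suc (π ⟨$⟩ʳ i))
  expand-step i with π ⟨$⟩ʳ i Fin.≟ k
  ... | yes eq = orbit-trans π⁺ (orbit-step π⁺ (π⁺-hit eq)) (orbit-step π⁺ (cong suc (sym eq)))
  ... | no neq = orbit-step π⁺ (π⁺-miss neq)

  expand-orbit : ∀ {i j} → Orbit π i j → Orbit π⁺ (suc i) (suc j)
  expand-orbit (zero  , refl) = orbit-refl π⁺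
  expand-orbit (suc l , refl) = orbit-trans π⁺ (expand-orbit (l , refl)) (expand-step _)

  -- Zero lies in the cycle of `suc k`, so the filter drops the one representative of that cycle,
  -- and zero itself replaces it.
  cyc-π⁺ : cyc π⁺ ≡ cyc π
  cyc-π⁺ = trans (cyc-suc π⁺ π (λ _ _ → expand-orbit) (λ i j → contract-orbit (suc i) (suc j)))
    (trans (cong (suc ∘ length) (filter-map-commute (¬? ∘ sameCycle? π k) (¬? ∘ sameCycle? π⁺ zero) suc
              (λ j ¬same → ¬same ∘ sameCycle-⇔ π⁺ π (contract-orbit zero (suc j)))
              (λ j ¬same → ¬same ∘ sameCycle-⇔ π π⁺ (orbit-trans π⁺ (orbit-step π⁺ refl) ∘ expand-orbit))
              reps))
    (trans (cong suc (List.length-map Fin.suc (filter (¬? ∘ sameCycle? π k) reps)))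
           (length-remove-class (sameCycle? π) same-sym same-trans reps
              (deduplicate-distinct (sameCycle? π) same-sym same-trans (allFin n))
              (deduplicate-represents (sameCycle? π) same-sym same-trans (allFin n)
                 (lose (∈-allFin k) (orbit⇒sameCycle π (orbit-refl π)))))))
    where
    reps = deduplicate (sameCycle? π) (allFin n)
    same-sym : ∀ {i j} → SameCycle π i j → SameCycle π j i
    same-sym = sameCycle-⇔ π π (orbit-sym π)
    same-trans : ∀ {i j l} → SameCycle π i j → SameCycle π j l → SameCycle π i l
    same-trans p q = orbit⇒sameCycle π (orbit-trans π (sameCycle⇒orbit π p) (sameCycle⇒orbit π q))

-- Connectedness of convex sets

abs< : ∀ {p q} → p ℚ.< q → ℚ.- p ℚ.< q → ℚ.∣ p ∣ ℚ.< q
abs< {p} {q} p<q -p<q with ℚ.∣p∣≡p∨∣p∣≡-p p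
... | inj₁ eq = subst (ℚ._< q) (sym eq) p<q
... | inj₂ eq = subst (ℚ._< q) (sym eq) -p<q

p≤∣p∣ : ∀ p → p ℚ.≤ ℚ.∣ p ∣
p≤∣p∣ p with ℚ.≤-total 0ℚ p
... | inj₁ 0≤p = ℚ.≤-reflexive (sym (ℚ.0≤p⇒∣p∣≡p 0≤p))
... | inj₂ p≤0 = ℚ.≤-trans p≤0 (ℚ.0≤∣p∣ p)

*-bound : ∀ u v {α β} → ℚ.∣ u ∣ ℚ.≤ α → ℚ.∣ v ∣ ℚ.≤ β → u ℚ.* v ℚ.≤ α ℚ.* β
*-bound u v {α} {β} u≤α v≤β = begin
  u ℚ.* v                    ≤⟨ p≤∣p∣ (u ℚ.* v) ⟩
  ℚ.∣ u ℚ.* v ∣              ≡⟨ ℚ.∣p*q∣≡∣p∣*∣q∣ u v ⟩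
  ℚ.∣ u ∣ ℚ.* ℚ.∣ v ∣        ≤⟨ ℚ.*-monoʳ-≤-nonNeg ℚ.∣ v ∣ {{ℚ.∣-∣-nonNeg v}} u≤α ⟩
  α ℚ.* ℚ.∣ v ∣              ≤⟨ ℚ.*-monoˡ-≤-nonNeg α {{ℚ.nonNegative (ℚ.≤-trans (ℚ.0≤∣p∣ u) u≤α)}} v≤β ⟩
  α ℚ.* β                    ∎
  where open ℚ.≤-Reasoning

0<1 : 0ℚ ℚ.< 1ℚ
0<1 = ℚ.positive⁻¹ 1ℚ

half<self : ∀ {ε} → 0ℚ ℚ.< ε → half ε ℚ.< ε
half<self {ε} 0<ε = subst₂ ℚ._<_ (ℚ.+-identityˡ (half ε)) (halves ε) (shift-< 0ℚ (half ε) (half ε) (half>0 0<ε))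

shrink : ℕ → ℚ
shrink zero    = 1ℚ
shrink (suc n) = half (shrink n)

private
  1/1+ : ℕ → ℚ
  1/1+ n = ℚ.mkℚ (ℤ.+ 1) n (ℕ.1-coprimeTo (suc n))

shrink≤ : ∀ n → shrink n ℚ.≤ 1/1+ n
shrink≤ zero    = ℚ.≤-refl
shrink≤ (suc n) = ℚ.≤-trans (ℚ.*-monoˡ-≤-nonNeg ½ (shrink≤ n)) (ℚ.toℚᵘ-cancel-≤ (ℚᵘ.≤-trans
  (ℚᵘ.≤-reflexive (ℚ.toℚᵘ-homo-* ½ (1/1+ n)))
  (ℚᵘ.*≤* (ℤ.+≤+ (subst₂ ℕ._≤_ (sym (ℕ.+-identityʳ _)) (sym (ℕ.+-identityʳ _))
    (ℕ.≤-trans (ℕ.m≤m+n (2 ℕ.+ n) n) (ℕ.≤-reflexive (cong suc (trans (cong suc (cong (n ℕ.+_) (sym (ℕ.+-identityʳ n)))) (sym (ℕ.+-suc n (n ℕ.+ 0))))))))))))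

shrink-vanishes : ∀ {δ} → 0ℚ ℚ.< δ → ∃[ n ] shrink n ℚ.< δ
-- δ is (p + 1)/(q + 1), and 2^-(q+1) ≤ 1/(q + 2) < 1/(q + 1) ≤ δ.
shrink-vanishes {ℚ.mkℚ (ℤ.+ suc p) q c} _ = suc q , ℚ.<-≤-trans (ℚ.≤-<-trans (shrink≤ (suc q)) lt) le
  where
  lt : 1/1+ (suc q) ℚ.< 1/1+ q
  lt = ℚ.*<* (ℤ.+<+ (subst₂ ℕ._<_ (sym (ℕ.+-identityʳ _)) (sym (ℕ.+-identityʳ _)) (ℕ.n<1+n (suc q))))
  le : 1/1+ q ℚ.≤ ℚ.mkℚ (ℤ.+ suc p) q c
  le = ℚ.*≤* (ℤ.+≤+ (ℕ.*-monoˡ-≤ (suc q) (ℕ.s≤s (ℕ.z≤n {p}))))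
shrink-vanishes {ℚ.mkℚ (ℤ.+ zero) q c} (ℚ.*<* (ℤ.+<+ ()))
shrink-vanishes {ℚ.mkℚ ℤ.-[1+ p ] q c} (ℚ.*<* ())

-- Convex combinations of reals

bounded : ∀ a → ∃[ M ] ℚ.Positive M × ∃[ N ] ∀ n → N ℕ.≤ n → ℚ.∣ seq a n ∣ ℚ.≤ M
bounded a = 1ℚ ℚ.+ ℚ.∣ seq a N ∣ , ℚ.pos+nonNeg⇒pos 1ℚ ℚ.∣ seq a N ∣ {{ℚ.∣-∣-nonNeg (seq a N)}} , N , bound
  where
  N = proj₁ (cauchy a 1ℚ 0<1)
  open +-*-Solver
  swap : ∀ p q → ℚ.- (p ℚ.- q) ≡ q ℚ.- p
  swap = solve 2 (λ p q → :- (p :- q) := q :- p) refl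
  split : ∀ p q → p ≡ (p ℚ.- q) ℚ.+ q
  split = solve 2 (λ p q → p := (p :- q) :+ q) refl
  bound : ∀ n → N ℕ.≤ n → ℚ.∣ seq a n ∣ ℚ.≤ 1ℚ ℚ.+ ℚ.∣ seq a N ∣
  bound n N≤n = begin
    ℚ.∣ aₙ ∣                         ≡⟨ cong ℚ.∣_∣ (split aₙ aN) ⟩
    ℚ.∣ (aₙ ℚ.- aN) ℚ.+ aN ∣         ≤⟨ ℚ.∣p+q∣≤∣p∣+∣q∣ (aₙ ℚ.- aN) aN ⟩
    ℚ.∣ aₙ ℚ.- aN ∣ ℚ.+ ℚ.∣ aN ∣     ≤⟨ ℚ.+-monoˡ-≤ ℚ.∣ aN ∣ (ℚ.<⇒≤ (abs< (p n N N≤n ℕ.≤-refl)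
                                          (subst (ℚ._< 1ℚ) (sym (swap aₙ aN)) (p N n ℕ.≤-refl N≤n)))) ⟩
    1ℚ ℚ.+ ℚ.∣ aN ∣                  ∎
    where
    open ℚ.≤-Reasoning
    aₙ = seq a n
    aN = seq a N
    p  = proj₂ (cauchy a 1ℚ 0<1)

-- A real parameter in [0,1], since the limit of a bisection is known only as a Cauchy sequence. The
-- bounds hold for every term, so that estimates can be made index by index.
record Weight : Set where
  field
    real : ℝ
    0≤s  : ∀ n → 0ℚ ℚ.≤ seq real n
    s≤1  : ∀ n → seq real n ℚ.≤ 1ℚ

  s : ℕ → ℚ
  s = seq real

open Weight

constʷ : ∀ q → 0ℚ ℚ.≤ q → q ℚ.≤ 1ℚ → Weight
constʷ q 0≤q q≤1 .real  = fromℚ q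
constʷ q 0≤q q≤1 .0≤s _ = 0≤q
constʷ q 0≤q q≤1 .s≤1 _ = q≤1

divide : ∀ {ε} M → 0ℚ ℚ.< ε → ℚ.Positive M → ∃[ δ ] 0ℚ ℚ.< δ × δ ℚ.* M ≡ ε
divide {ε} M 0<ε M>0 = ε ℚ.* M⁻¹ ,
  ℚ.positive⁻¹ (ε ℚ.* M⁻¹) {{ℚ.pos*pos⇒pos ε {{ℚ.positive 0<ε}} M⁻¹ {{ℚ.1/pos⇒pos M {{M>0}}}}}} ,
  trans (ℚ.*-assoc ε M⁻¹ M) (trans (cong (ε ℚ.*_) (ℚ.*-inverseˡ M {{M≢0}})) (ℚ.*-identityʳ ε))
  where
  M≢0 = ℚ.pos⇒nonZero M {{M>0}}
  M⁻¹ = (ℚ.1/ M) {{M≢0}}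

sub-swap : ∀ p q → q ℚ.- p ≡ ℚ.- (p ℚ.- q)
sub-swap = solve 2 (λ p q → q :- p := :- (p :- q)) refl
  where open +-*-Solver

close-abs : ∀ p q {ε} → p ℚ.- q ℚ.< ε → q ℚ.- p ℚ.< ε → ℚ.∣ p ℚ.- q ∣ ℚ.< ε
close-abs p q {ε} lt gt = abs< lt (subst (ℚ._< ε) (sub-swap p q) gt)

-- The difference of two products splits as (s - t) a + t (a - b): the first part is controlled by
-- an eventual bound M on a, the second by 0 ≤ t ≤ 1.
scale : Weight → ℝ → ℝ
scale w a .seq n        = s w n ℚ.* seq a n
scale w a .cauchy ε 0<ε =
  let (M , M>0 , N₀ , bd)  = bounded a
      (δ , 0<δ , δM≡ε/2) = divide M (half>0 0<ε) M>0
      (N₁ , p) = cauchy (real w) δ 0<δ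
      (N₂ , q) = cauchy a (half ε) (half>0 0<ε)
  in N₀ ℕ.⊔ (N₁ ℕ.⊔ N₂) , λ m n m≥ n≥ →
    let m≥′ = ℕ.m⊔n≤o⇒n≤o N₀ (N₁ ℕ.⊔ N₂) m≥
        n≥′ = ℕ.m⊔n≤o⇒n≤o N₀ (N₁ ℕ.⊔ N₂) n≥
        m₁ = ℕ.m⊔n≤o⇒m≤o N₁ N₂ m≥′ ; n₁ = ℕ.m⊔n≤o⇒m≤o N₁ N₂ n≥′
        m₂ = ℕ.m⊔n≤o⇒n≤o N₁ N₂ m≥′ ; n₂ = ℕ.m⊔n≤o⇒n≤o N₁ N₂ n≥′
        sₘ = s w m ; sₙ = s w n ; aₘ = seq a m ; aₙ = seq a n
    in begin-strict
    sₘ ℚ.* aₘ ℚ.- sₙ ℚ.* aₙ                         ≡⟨ split sₘ sₙ aₘ aₙ ⟩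
    (sₘ ℚ.- sₙ) ℚ.* aₘ ℚ.+ sₙ ℚ.* (aₘ ℚ.- aₙ)       ≤⟨ ℚ.+-mono-≤
        (*-bound (sₘ ℚ.- sₙ) aₘ {δ} {M} (ℚ.<⇒≤ (close-abs sₘ sₙ (p m n m₁ n₁) (p n m n₁ m₁))) (bd m (ℕ.m⊔n≤o⇒m≤o N₀ _ m≥)))
        (*-bound sₙ (aₘ ℚ.- aₙ) {1ℚ} (subst (ℚ._≤ 1ℚ) (sym (ℚ.0≤p⇒∣p∣≡p (0≤s w n))) (s≤1 w n)) ℚ.≤-refl) ⟩
    δ ℚ.* M ℚ.+ 1ℚ ℚ.* ℚ.∣ aₘ ℚ.- aₙ ∣               ≡⟨ cong₂ ℚ._+_ δM≡ε/2 (ℚ.*-identityˡ _) ⟩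
    half ε ℚ.+ ℚ.∣ aₘ ℚ.- aₙ ∣                       <⟨ ℚ.+-monoʳ-< (half ε) (close-abs aₘ aₙ (q m n m₂ n₂) (q n m n₂ m₂)) ⟩
    half ε ℚ.+ half ε                               ≡⟨ halves ε ⟩
    ε                                               ∎
  where
  open ℚ.≤-Reasoning
  open +-*-Solver
  split : ∀ s t a b → s ℚ.* a ℚ.- t ℚ.* b ≡ (s ℚ.- t) ℚ.* a ℚ.+ t ℚ.* (a ℚ.- b)
  split = solve 4 (λ s t a b → s :* a :- t :* b := (s :- t) :* a :+ t :* (a :- b)) refl

Close : ℚ → Weight → Weight → Set
Close δ w v = ∃[ N ] ∀ n → N ℕ.≤ n → ℚ.∣ s w n ℚ.- s v n ∣ ℚ.≤ δ

near-≗ : ∀ {a b ε} → 0ℚ ℚ.< ε → (∀ n → seq a n ≡ seq b n) → Near ε a b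
near-≗ {a} {b} {ε} 0<ε eq = near (lt a b eq) (lt b a (sym ∘ eq))
  where
  lt : ∀ a b → (∀ n → seq a n ≡ seq b n) → a -ℝ b <ℝ fromℚ ε
  lt a b eq = gap (half ε) (half>0 0<ε) 0 λ n _ →
    subst (λ z → z ℚ.+ half ε ℚ.< ε)
      (sym (trans (cong (λ z → z ℚ.- seq b n) (eq n)) (ℚ.+-inverseʳ (seq b n))))
      (subst (ℚ._< ε) (sym (ℚ.+-identityˡ (half ε))) (half<self 0<ε))

near-scale : ∀ a ε → 0ℚ ℚ.< ε → ∃[ δ ] 0ℚ ℚ.< δ × (∀ w v → Close δ w v → Near ε (scale w a) (scale v a))
near-scale a ε 0<ε =
  let (M , M>0 , N₀ , bd) = bounded a
      -- The products then differ by at most ε/4, and adding the gap ε/2 that `_<ℝ_` requires still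
      -- stays below ε.
      (δ , 0<δ , δM≡)     = divide M (half>0 (half>0 0<ε)) M>0
  in δ , 0<δ , λ { w v (N , close) →
    near (one w v M N₀ N δ bd δM≡ close)
         (one v w M N₀ N δ bd δM≡ λ n n≥ →
            subst (ℚ._≤ δ) (trans (sym (ℚ.∣-p∣≡∣p∣ _)) (cong ℚ.∣_∣ (sym (sub-swap (s w n) (s v n))))) (close n n≥)) }
  where
  open ℚ.≤-Reasoning
  open +-*-Solver
  factor : ∀ s t a → s ℚ.* a ℚ.- t ℚ.* a ≡ (s ℚ.- t) ℚ.* a
  factor = solve 3 (λ s t a → s :* a :- t :* a := (s :- t) :* a) refl
  one : ∀ w v M N₀ N δ → (∀ n → N₀ ℕ.≤ n → ℚ.∣ seq a n ∣ ℚ.≤ M) → δ ℚ.* M ≡ half (half ε) →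
        (∀ n → N ℕ.≤ n → ℚ.∣ s w n ℚ.- s v n ∣ ℚ.≤ δ) → scale w a -ℝ scale v a <ℝ fromℚ ε
  one w v M N₀ N δ bd δM≡ close = gap (half ε) (half>0 0<ε) (N₀ ℕ.⊔ N) λ n n≥ → begin-strict
    (s w n ℚ.* seq a n ℚ.- s v n ℚ.* seq a n) ℚ.+ half ε ≡⟨ cong (ℚ._+ half ε) (factor (s w n) (s v n) (seq a n)) ⟩
    (s w n ℚ.- s v n) ℚ.* seq a n ℚ.+ half ε
      ≤⟨ ℚ.+-monoˡ-≤ (half ε) (*-bound (s w n ℚ.- s v n) (seq a n) (close n (ℕ.m⊔n≤o⇒n≤o N₀ N n≥)) (bd n (ℕ.m⊔n≤o⇒m≤o N₀ N n≥))) ⟩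
    δ ℚ.* M ℚ.+ half ε                     ≡⟨ cong (ℚ._+ half ε) δM≡ ⟩
    half (half ε) ℚ.+ half ε               <⟨ ℚ.+-monoˡ-< (half ε) (half<self (half>0 0<ε)) ⟩
    half ε ℚ.+ half ε                      ≡⟨ halves ε ⟩
    ε                                      ∎

-- The convex combination (1 - w) a + w b, written with a single product; w = 0 gives a and w = 1
-- gives b.
mix : Weight → ℝ → ℝ → ℝ
mix w a b = a -ℝ scale w (a -ℝ b)

near-mix : ∀ a b ε → 0ℚ ℚ.< ε → ∃[ δ ] 0ℚ ℚ.< δ × (∀ w v → Close δ w v → Near ε (mix w a b) (mix v a b))
near-mix a b ε 0<ε =
  let (δ , 0<δ , h) = near-scale (a -ℝ b) (half ε) (half>0 0<ε)
  in δ , 0<δ , λ w v c → near-sub ε (near-≗ (half>0 0<ε) (λ _ → refl)) (h w v c)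

<ℝ-resp-≗ : ∀ {a b a′ b′} → (∀ n → seq a n ≡ seq a′ n) → (∀ n → seq b n ≡ seq b′ n) → a <ℝ b → a′ <ℝ b′
<ℝ-resp-≗ {a} {b} {a′} {b′} p q (gap ε 0<ε N lt) = gap ε 0<ε N λ n h →
  resp-< _ _ _ _ (cong (ℚ._+ ε) (p n)) (q n) (lt n h)

-- The smaller gap δ serves both inequalities, and a convex combination preserves it as a weak
-- bound; halving δ makes the bound strict again.
mix-< : ∀ w {a b a′ b′} → a <ℝ a′ → b <ℝ b′ → mix w a b <ℝ mix w a′ b′
mix-< w {a} {b} {a′} {b′} (gap α 0<α N p) (gap β 0<β N′ q) =
  gap (half δ) (half>0 0<δ) (N ℕ.⊔ N′) λ n h →
    let a₀ = seq a n ; b₀ = seq b n ; a₁ = seq a′ n ; b₁ = seq b′ n ; t = s w n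
        A≥0 : 0ℚ ℚ.≤ a₁ ℚ.- (a₀ ℚ.+ δ)
        A≥0 = slack a₀ (ℚ.p⊓q≤p α β) (p n (ℕ.m⊔n≤o⇒m≤o N N′ h))
        B≥0 : 0ℚ ℚ.≤ b₁ ℚ.- (b₀ ℚ.+ δ)
        B≥0 = slack b₀ (ℚ.p⊓q≤q α β) (q n (ℕ.m⊔n≤o⇒n≤o N N′ h))
    in begin-strict
    (a₀ ℚ.- t ℚ.* (a₀ ℚ.- b₀)) ℚ.+ half δ    <⟨ ℚ.+-monoʳ-< (a₀ ℚ.- t ℚ.* (a₀ ℚ.- b₀)) (half<self 0<δ) ⟩
    (a₀ ℚ.- t ℚ.* (a₀ ℚ.- b₀)) ℚ.+ δ         ≡⟨ sym (ℚ.+-identityʳ _) ⟩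
    ((a₀ ℚ.- t ℚ.* (a₀ ℚ.- b₀)) ℚ.+ δ) ℚ.+ (0ℚ ℚ.+ 0ℚ)
      ≤⟨ ℚ.+-monoʳ-≤ ((a₀ ℚ.- t ℚ.* (a₀ ℚ.- b₀)) ℚ.+ δ)
           (ℚ.+-mono-≤ (0≤* (diff (s≤1 w n)) A≥0) (0≤* (0≤s w n) B≥0)) ⟩
    ((a₀ ℚ.- t ℚ.* (a₀ ℚ.- b₀)) ℚ.+ δ) ℚ.+ ((1ℚ ℚ.- t) ℚ.* (a₁ ℚ.- (a₀ ℚ.+ δ)) ℚ.+ t ℚ.* (b₁ ℚ.- (b₀ ℚ.+ δ)))
      ≡⟨ identity a₀ b₀ a₁ b₁ t δ ⟩
    a₁ ℚ.- t ℚ.* (a₁ ℚ.- b₁)                 ∎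
  where
  open ℚ.≤-Reasoning
  open +-*-Solver
  δ = α ℚ.⊓ β
  0<δ = ⊓-pos 0<α 0<β
  diff : ∀ {u v} → u ℚ.≤ v → 0ℚ ℚ.≤ v ℚ.- u
  diff {u} {v} u≤v = subst (ℚ._≤ v ℚ.- u) (ℚ.+-inverseʳ u) (ℚ.+-monoˡ-≤ (ℚ.- u) u≤v)
  slack : ∀ u {v γ} → δ ℚ.≤ γ → u ℚ.+ γ ℚ.< v → 0ℚ ℚ.≤ v ℚ.- (u ℚ.+ δ)
  slack u δ≤γ lt = diff (ℚ.≤-trans (ℚ.+-monoʳ-≤ u δ≤γ) (ℚ.<⇒≤ lt))
  0≤* : ∀ {u v} → 0ℚ ℚ.≤ u → 0ℚ ℚ.≤ v → 0ℚ ℚ.≤ u ℚ.* v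
  0≤* {u} {v} 0≤u 0≤v = ℚ.nonNegative⁻¹ (u ℚ.* v)
    {{ℚ.nonNeg*nonNeg⇒nonNeg u {{ℚ.nonNegative 0≤u}} v {{ℚ.nonNegative 0≤v}}}}
  identity : ∀ a b a′ b′ t δ →
    ((a ℚ.- t ℚ.* (a ℚ.- b)) ℚ.+ δ) ℚ.+ ((1ℚ ℚ.- t) ℚ.* (a′ ℚ.- (a ℚ.+ δ)) ℚ.+ t ℚ.* (b′ ℚ.- (b ℚ.+ δ)))
    ≡ a′ ℚ.- t ℚ.* (a′ ℚ.- b′)
  identity = solve 6 (λ a b a′ b′ t δ →
    ((a :- t :* (a :- b)) :+ δ) :+ ((con 1ℚ :- t) :* (a′ :- (a :+ δ)) :+ t :* (b′ :- (b :+ δ)))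
    := a′ :- t :* (a′ :- b′)) refl

mix-sub : ∀ w a b a′ b′ n → seq (mix w (a -ℝ a′) (b -ℝ b′)) n ≡ seq (mix w a b -ℝ mix w a′ b′) n
mix-sub w a b a′ b′ n = eq (seq a n) (seq b n) (seq a′ n) (seq b′ n) (s w n)
  where
  open +-*-Solver
  eq : ∀ a b a′ b′ t → (a ℚ.- a′) ℚ.- t ℚ.* ((a ℚ.- a′) ℚ.- (b ℚ.- b′))
       ≡ (a ℚ.- t ℚ.* (a ℚ.- b)) ℚ.- (a′ ℚ.- t ℚ.* (a′ ℚ.- b′))
  eq = solve 5 (λ a b a′ b′ t → (a :- a′) :- t :* ((a :- a′) :- (b :- b′))
       := (a :- t :* (a :- b)) :- (a′ :- t :* (a′ :- b′))) refl

mix-0 : ∀ a b n → seq a n ≡ seq (mix (constʷ 0ℚ ℚ.≤-refl (ℚ.<⇒≤ 0<1)) a b) n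
mix-0 a b n = eq (seq a n) (seq b n)
  where
  open +-*-Solver
  eq : ∀ a b → a ≡ a ℚ.- 0ℚ ℚ.* (a ℚ.- b)
  eq = solve 2 (λ a b → a := a :- con 0ℚ :* (a :- b)) refl

mix-1 : ∀ a b n → seq b n ≡ seq (mix (constʷ 1ℚ (ℚ.<⇒≤ 0<1) ℚ.≤-refl) a b) n
mix-1 a b n = eq (seq a n) (seq b n)
  where
  open +-*-Solver
  eq : ∀ a b → b ≡ a ℚ.- 1ℚ ℚ.* (a ℚ.- b)
  eq = solve 2 (λ a b → b := a :- con 1ℚ :* (a :- b)) refl

path : Weight → ℝ^ d → ℝ^ d → ℝ^ d
path w p q k = mix w (p k) (q k)

Convex : Pred (ℝ^ d) 0ℓ → Set
Convex C = ∀ w p q → C p → C q → C (path w p q)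

least : (P : Fin d → ℚ → Set) → (∀ k {γ δ} → γ ℚ.≤ δ → P k δ → P k γ) →
        (∀ k → ∃[ δ ] 0ℚ ℚ.< δ × P k δ) → ∃[ δ ] 0ℚ ℚ.< δ × (∀ k → P k δ)
least {zero}  P down ex = 1ℚ , 0<1 , λ ()
least {suc d} P down ex =
  let (δ , 0<δ , p) = ex zero
      (γ , 0<γ , q) = least (P ∘ suc) (down ∘ suc) (ex ∘ suc)
  in δ ℚ.⊓ γ , ⊓-pos 0<δ 0<γ , λ
     { zero    → down zero (ℚ.p⊓q≤p δ γ) p
     ; (suc k) → down (suc k) (ℚ.p⊓q≤q δ γ) (q k) }

near-path : (p q : ℝ^ d) → ∀ ε → 0ℚ ℚ.< ε →
            ∃[ δ ] 0ℚ ℚ.< δ × (∀ k w v → Close δ w v → Near ε (path w p q k) (path v p q k))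
near-path p q ε 0<ε =
  least (λ k δ → ∀ w v → Close δ w v → Near ε (path w p q k) (path v p q k))
        (λ { k γ≤δ h w v (N , c) → h w v (N , λ n n≥ → ℚ.≤-trans (c n n≥) γ≤δ) })
        (λ k → near-mix (p k) (q k) ε 0<ε)

-- The lower ends of the brackets lie in U and the upper ends in V; whichever of
-- the two open sets contains the limit contains a whole bracket near it.
module Bisection {C U V : Pred (ℝ^ d) 0ℓ} (conv : Convex C) (oU : OpenIn C U) (oV : OpenIn C V)
                 (cov : C ⊆ U ∪ V) {p q : ℝ^ d} (Cp : C p) (Up : U p) (Cq : C q) (Vq : V q) where

  pt : Weight → ℝ^ d
  pt w = path w p q

  pt∈C : ∀ w → C (pt w)
  pt∈C w = conv w p q Cp Cq

  record Bracket (n : ℕ) : Set where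
    field
      lo hi       : ℚ
      0≤lo        : 0ℚ ℚ.≤ lo
      lo≤1        : lo ℚ.≤ 1ℚ
      0≤hi        : 0ℚ ℚ.≤ hi
      hi≤1        : hi ℚ.≤ 1ℚ
      lo≤hi       : lo ℚ.≤ hi
      width       : hi ℚ.- lo ≡ shrink n
      lo∈U        : U (pt (constʷ lo 0≤lo lo≤1))
      hi∈V        : V (pt (constʷ hi 0≤hi hi≤1))

  open Bracket

  start : Bracket 0
  start = record
    { lo = 0ℚ ; hi = 1ℚ
    ; 0≤lo = ℚ.≤-refl ; lo≤1 = ℚ.<⇒≤ 0<1 ; 0≤hi = ℚ.<⇒≤ 0<1 ; hi≤1 = ℚ.≤-refl ; lo≤hi = ℚ.<⇒≤ 0<1
    ; width = refl
    -- The path at weight 0 agrees with p only term by term, which an arbitrary predicate U need not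
    -- respect; openness of U carries membership over.
    ; lo∈U = let (ε , 0<ε , h) = oU p Cp Up in h _ (pt∈C _) (λ k → near-≗ 0<ε (mix-0 (p k) (q k)))
    ; hi∈V = let (ε , 0<ε , h) = oV q Cq Vq in h _ (pt∈C _) (λ k → near-≗ 0<ε (mix-1 (p k) (q k)))
    }

  module _ {n : ℕ} (b : Bracket n) where
    open +-*-Solver

    mid : ℚ
    mid = half (lo b ℚ.+ hi b)

    half-double : ∀ r → half (r ℚ.+ r) ≡ r
    half-double = solve 1 (λ r → con ½ :* (r :+ r) := r) refl

    lo≤mid : lo b ℚ.≤ mid
    lo≤mid = subst (ℚ._≤ mid) (half-double (lo b)) (ℚ.*-monoˡ-≤-nonNeg ½ (ℚ.+-monoʳ-≤ (lo b) (lo≤hi b)))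

    mid≤hi : mid ℚ.≤ hi b
    mid≤hi = subst (mid ℚ.≤_) (half-double (hi b)) (ℚ.*-monoˡ-≤-nonNeg ½ (ℚ.+-monoˡ-≤ (hi b) (lo≤hi b)))

    0≤mid : 0ℚ ℚ.≤ mid
    0≤mid = ℚ.≤-trans (0≤lo b) lo≤mid

    mid≤1 : mid ℚ.≤ 1ℚ
    mid≤1 = ℚ.≤-trans mid≤hi (hi≤1 b)

    lower-width : ∀ l h → half (l ℚ.+ h) ℚ.- l ≡ half (h ℚ.- l)
    lower-width = solve 2 (λ l h → con ½ :* (l :+ h) :- l := con ½ :* (h :- l)) refl

    upper-width : ∀ l h → h ℚ.- half (l ℚ.+ h) ≡ half (h ℚ.- l)
    upper-width = solve 2 (λ l h → h :- con ½ :* (l :+ h) := con ½ :* (h :- l)) refl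

    step : ∃[ b′ ] lo b ℚ.≤ lo {suc n} b′ × hi b′ ℚ.≤ hi b
    step = choose (cov (pt∈C (constʷ mid 0≤mid mid≤1)))
      where
      choose : U (pt (constʷ mid 0≤mid mid≤1)) ⊎ V (pt (constʷ mid 0≤mid mid≤1)) →
               ∃[ b′ ] lo b ℚ.≤ lo {suc n} b′ × hi b′ ℚ.≤ hi b
      choose (inj₁ u) = record
        { lo = mid ; hi = hi b ; 0≤lo = 0≤mid ; lo≤1 = mid≤1 ; 0≤hi = 0≤hi b ; hi≤1 = hi≤1 b ; lo≤hi = mid≤hi
        ; width = trans (upper-width (lo b) (hi b)) (cong half (width b)) ; lo∈U = u ; hi∈V = hi∈V b }
        , lo≤mid , ℚ.≤-refl
      choose (inj₂ v) = record
        { lo = lo b ; hi = mid ; 0≤lo = 0≤lo b ; lo≤1 = lo≤1 b ; 0≤hi = 0≤mid ; hi≤1 = mid≤1 ; lo≤hi = lo≤mid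
        ; width = trans (lower-width (lo b) (hi b)) (cong half (width b)) ; lo∈U = lo∈U b ; hi∈V = v }
        , ℚ.≤-refl , mid≤hi

  bracket : ∀ n → Bracket n
  bracket zero    = start
  bracket (suc n) = proj₁ (step (bracket n))

  loₙ hiₙ : ℕ → ℚ
  loₙ n = lo (bracket n)
  hiₙ n = hi (bracket n)

  nested′ : ∀ {n k} → n ℕ.≤′ k → loₙ n ℚ.≤ loₙ k × hiₙ k ℚ.≤ hiₙ n
  nested′ ℕ.≤′-refl       = ℚ.≤-refl , ℚ.≤-refl
  nested′ {k = suc k} (ℕ.≤′-step le) =
    let (l , h) = nested′ le ; (l′ , h′) = proj₂ (step (bracket k)) in
    ℚ.≤-trans l l′ , ℚ.≤-trans h′ h

  lo≤lo : ∀ {n k} → n ℕ.≤ k → loₙ n ℚ.≤ loₙ k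
  lo≤lo le = proj₁ (nested′ (ℕ.≤⇒≤′ le))

  lo≤hiₙ : ∀ {n k} → n ℕ.≤ k → loₙ k ℚ.≤ hiₙ n
  lo≤hiₙ {k = k} le = ℚ.≤-trans (lo≤hi (bracket k)) (proj₂ (nested′ (ℕ.≤⇒≤′ le)))

  spread : ∀ {n} u v → u ℚ.≤ hiₙ n → loₙ n ℚ.≤ v → u ℚ.- v ℚ.≤ shrink n
  spread {n} u v u≤ v≥ = subst (u ℚ.- v ℚ.≤_) (width (bracket n)) (ℚ.+-mono-≤ u≤ (ℚ.neg-antimono-≤ v≥))

  limit : Weight
  limit .real .seq         = loₙ
  limit .real .cauchy ε 0<ε =
    let (N , lt) = shrink-vanishes 0<ε in
    N , λ m n N≤m N≤n → ℚ.≤-<-trans (spread {N} (loₙ m) (loₙ n) (lo≤hiₙ N≤m) (lo≤lo N≤n)) lt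
  limit .0≤s n = 0≤lo (bracket n)
  limit .s≤1 n = lo≤1 (bracket n)

  ∣-∣≤ : ∀ u v {e} → u ℚ.- v ℚ.≤ e → v ℚ.- u ℚ.≤ e → ℚ.∣ u ℚ.- v ∣ ℚ.≤ e
  ∣-∣≤ u v {e} le ge with ℚ.∣p∣≡p∨∣p∣≡-p (u ℚ.- v)
  ... | inj₁ eq = subst (ℚ._≤ e) (sym eq) le
  ... | inj₂ eq = subst (ℚ._≤ e) (sym (trans eq (sym (sub-swap u v)))) ge

  -- From index n on, the sequence of the limit stays in the n-th bracket, as does r, so they differ
  -- by at most its width.
  near-limit : ∀ ε → 0ℚ ℚ.< ε → ∃[ n ] ∀ r (0≤r : 0ℚ ℚ.≤ r) (r≤1 : r ℚ.≤ 1ℚ) →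
               loₙ n ℚ.≤ r → r ℚ.≤ hiₙ n → ∀ k → Near ε (pt limit k) (pt (constʷ r 0≤r r≤1) k)
  near-limit ε 0<ε =
    let (δ , 0<δ , h) = near-path p q ε 0<ε
        (n , lt)      = shrink-vanishes 0<δ
    in n , λ r 0≤r r≤1 l≤r r≤h k → h k limit (constʷ r 0≤r r≤1) (n , λ j n≤j →
       ℚ.≤-trans (∣-∣≤ (loₙ j) r (spread {n} (loₙ j) r (lo≤hiₙ n≤j) l≤r) (spread {n} r (loₙ j) r≤h (lo≤lo n≤j)))
                 (ℚ.<⇒≤ lt))

  meet : ∃[ z ] C z × U z × V z
  meet = choose (cov (pt∈C limit))
   where
   choose : U (pt limit) ⊎ V (pt limit) → ∃[ z ] C z × U z × V z
   choose (inj₁ u) =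
    let (ε , 0<ε , h) = oU (pt limit) (pt∈C limit) u
        (n , close)   = near-limit ε 0<ε
        b             = bracket n
    in pt (constʷ (hi b) (0≤hi b) (hi≤1 b)) , pt∈C _ ,
       h (pt (constʷ (hi b) (0≤hi b) (hi≤1 b))) (pt∈C _) (close (hi b) (0≤hi b) (hi≤1 b) (lo≤hi b) ℚ.≤-refl) , hi∈V b
   choose (inj₂ v) =
    let (ε , 0<ε , h) = oV (pt limit) (pt∈C limit) v
        (n , close)   = near-limit ε 0<ε
        b             = bracket n
    in pt (constʷ (lo b) (0≤lo b) (lo≤1 b)) , pt∈C _ ,
       lo∈U b , h (pt (constʷ (lo b) (0≤lo b) (lo≤1 b))) (pt∈C _) (close (lo b) (0≤lo b) (lo≤1 b) ℚ.≤-refl (lo≤hi b))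

convex⇒connected : {C : Pred (ℝ^ d) 0ℓ} → Convex C → Connected C
convex⇒connected {C = C} conv U V oU oV cov (p , Cp , Up) (q , Cq , Vq) =
  Bisection.meet {C = C} {U} {V} conv oU oV cov Cp Up Cq Vq

-- Regions

sub-antimono-< : ∀ c {a b} → a <ℝ b → c -ℝ b <ℝ c -ℝ a
sub-antimono-< c {a} {b} (gap ε 0<ε N p) = gap ε 0<ε N λ n h →
  resp-< _ _ _ _ (l (seq a n) (seq b n) (seq c n) ε) (r (seq a n) (seq b n) (seq c n))
    (shift-< (seq a n ℚ.+ ε) (seq b n) (seq c n ℚ.- seq a n ℚ.- seq b n) (p n h))
  where
  open +-*-Solver
  l : ∀ a b c ε → (a ℚ.+ ε) ℚ.+ (c ℚ.- a ℚ.- b) ≡ (c ℚ.- b) ℚ.+ ε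
  l = solve 4 (λ a b c ε → (a :+ ε) :+ (c :- a :- b) := (c :- b) :+ ε) refl
  r : ∀ a b c → b ℚ.+ (c ℚ.- a ℚ.- b) ≡ c ℚ.- a
  r = solve 3 (λ a b c → b :+ (c :- a :- b) := c :- a) refl

<⇒sub<0 : ∀ a b → a <ℝ b → a -ℝ b <ℝ 0ℝ
<⇒sub<0 a b a<b = <ℝ-resp-≗ (λ _ → refl) (λ n → ℚ.+-inverseʳ (seq a n)) (sub-antimono-< a {a} {b} a<b)

>⇒0<sub : ∀ a b → b <ℝ a → 0ℝ <ℝ a -ℝ b
>⇒0<sub a b b<a = <ℝ-resp-≗ (λ n → ℚ.+-inverseʳ (seq a n)) (λ _ → refl) (sub-antimono-< a {b} {a} b<a)

count-mono : {P Q : Pred (Fin n) 0ℓ} (P? : Decidable P) (Q? : Decidable Q) → (∀ i → P i → Q i) → count P? ℕ.≤ count Q?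
count-mono {zero}  P? Q? f = z≤n
count-mono {suc n} P? Q? f with count-mono (P? ∘ suc) (Q? ∘ suc) (f ∘ suc) | P? zero | Q? zero
... | le | yes p | yes q = s≤s le
... | le | yes p | no ¬q = contradiction (f zero p) ¬q
... | le | no ¬p | yes q = ℕ.m≤n⇒m≤1+n le
... | le | no ¬p | no ¬q = le

count-strict : {P Q : Pred (Fin n) 0ℓ} (P? : Decidable P) (Q? : Decidable Q) → (∀ i → P i → Q i) →
               ∀ j → ¬ P j → Q j → count P? ℕ.< count Q?
count-strict {suc n} P? Q? f zero ¬Pj Qj with count-mono (P? ∘ suc) (Q? ∘ suc) (f ∘ suc) | P? zero | Q? zero
... | le | yes p | _     = contradiction p ¬Pj
... | le | no ¬p | yes q = s≤s le
... | le | no ¬p | no ¬q = contradiction Qj ¬q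
count-strict {suc n} P? Q? f (suc j) ¬Pj Qj with count-strict (P? ∘ suc) (Q? ∘ suc) (f ∘ suc) j ¬Pj Qj | P? zero | Q? zero
... | lt | yes p | yes q = s≤s lt
... | lt | yes p | no ¬q = contradiction (f zero p) ¬q
... | lt | no ¬p | yes q = ℕ.m≤n⇒m≤1+n lt
... | lt | no ¬p | no ¬q = lt

-- The points on the same side of every hyperplane as A. As A is off the hyperplanes, each
-- comparison holds at A in one direction or the other, and the implications carry that direction
-- over to z.
Cell : Region m → Pred (ℝ^ (suc m ℕ.+ m)) 0ℓ
Cell {m} A z =
  (∀ i j → x A i <ℝ x A j → xᶜ m z i <ℝ xᶜ m z j) ×
  (∀ i j → inject₁ i Fin.< j →
    (x A (inject₁ i) -ℝ x A j <ℝ y A i → xᶜ m z (inject₁ i) -ℝ xᶜ m z j <ℝ yᶜ m z i) ×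
    (y A i <ℝ x A (inject₁ i) -ℝ x A j → yᶜ m z i <ℝ xᶜ m z (inject₁ i) -ℝ xᶜ m z j))

cell-convex : (A : Region m) → Convex (Cell A)
cell-convex {m} A w p q (px , py) (qx , qy) =
  (λ i j lt → mix-< w (px i j lt) (qx i j lt)) ,
  λ i j i<j →
    (λ lt → <ℝ-resp-≗ (mix-sub w (xᶜ m p (inject₁ i)) (xᶜ m q (inject₁ i)) (xᶜ m p j) (xᶜ m q j)) (λ _ → refl)
              (mix-< w (proj₁ (py i j i<j) lt) (proj₁ (qy i j i<j) lt))) ,
    (λ gt → <ℝ-resp-≗ (λ _ → refl) (mix-sub w (xᶜ m p (inject₁ i)) (xᶜ m q (inject₁ i)) (xᶜ m p j) (xᶜ m q j))
              (mix-< w (proj₂ (py i j i<j) gt) (proj₂ (qy i j i<j) gt)))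

cell-self : (A : Region m) → Cell A (Region.point A)
cell-self A = (λ _ _ lt → lt) , λ _ _ _ → (λ lt → lt) , (λ gt → gt)

cell-off : (A : Region m) → Cell A ⊆ OffHyperplanes m
cell-off {m} A {z} (cx , cy) = offx , offy
  where
  offx : ∀ {i j : Fin (suc m)} → i Fin.< j → (xᶜ m z i -ℝ xᶜ m z j) # 0ℝ
  offx {i} {j} i<j with off⇒# (Region.point A) (Region.off A) (Fin.<⇒≢ i<j)
  ... | inj₁ lt = inj₁ (<⇒sub<0 (xᶜ m z i) (xᶜ m z j) (cx i j lt))
  ... | inj₂ gt = inj₂ (>⇒0<sub (xᶜ m z i) (xᶜ m z j) (cx j i gt))
  offy : ∀ {i : Fin m} {j : Fin (suc m)} → inject₁ i Fin.< j → (xᶜ m z (inject₁ i) -ℝ xᶜ m z j) # yᶜ m z i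
  offy {i} {j} i<j with proj₂ (Region.off A) i<j
  ... | inj₁ lt = inj₁ (proj₁ (cy i j i<j) lt)
  ... | inj₂ gt = inj₂ (proj₂ (cy i j i<j) gt)

∼-refl : (A : Region m) → A ∼ A
∼-refl A = joined-refl (Region.off A)

σ-sorts : (A : Region m) → ∀ {i j} → i Fin.< j → x A (σ A ⟨$⟩ʳ i) <ℝ x A (σ A ⟨$⟩ʳ j)
σ-sorts A = proj₂ (σ-exists A) A (∼-refl A)

lehmer-τ : (A : Region m) → ∀ i → lehmer (τ A) (inject₁ i) ≡ ℓᵢ A i
lehmer-τ A = proj₁ (proj₂ (τ-exists A) A (∼-refl A))

lehmer-last : (π : Permutation′ (suc m)) → lehmer π (fromℕ m) ≡ 0
lehmer-last {m} π = count-none (λ j → (fromℕ m Fin.<? j) ×-dec ((π ⟨$⟩ʳ j) Fin.<? (π ⟨$⟩ʳ fromℕ m)))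
  λ { j (lt , _) → ℕ.<⇒≱ lt (Fin.≤fromℕ j) }

-- The order of the xᵢ is that of the places σ⁻¹(i), which the two regions share. Places, unlike
-- reals, can always be compared.
order-transfer : (A B : Region m) → σ A ≈ₚ σ B → ∀ i j → x A i <ℝ x A j → x B i <ℝ x B j
order-transfer {m} A B σ≈ i j lt = choose (Fin.<-cmp (σ A ⟨$⟩ˡ i) (σ A ⟨$⟩ˡ j))
  where
  back : ∀ i → σ B ⟨$⟩ʳ (σ A ⟨$⟩ˡ i) ≡ i
  back i = trans (sym (σ≈ (σ A ⟨$⟩ˡ i))) (inverseʳ (σ A))
  choose : Tri (σ A ⟨$⟩ˡ i Fin.< σ A ⟨$⟩ˡ j) (σ A ⟨$⟩ˡ i ≡ σ A ⟨$⟩ˡ j) (σ A ⟨$⟩ˡ j Fin.< σ A ⟨$⟩ˡ i) →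
           x B i <ℝ x B j
  choose (tri< a<b _ _) = subst₂ (λ u v → x B u <ℝ x B v) (back i) (back j) (σ-sorts B a<b)
  choose (tri≈ _ eq _)  = contradiction lt
    (subst (λ v → ¬ (x A i <ℝ x A v)) (injective (flip (σ A)) eq) (λ a → <ℝ-asym a a))
  choose (tri> _ _ b<a) = contradiction
    (subst₂ (λ u v → x A u <ℝ x A v) (inverseʳ (σ A)) (inverseʳ (σ A)) (σ-sorts A b<a)) (<ℝ-asym lt)

-- The j counted by ℓᵢ form an up-set in the order of the xⱼ, so two such sets
-- of the same size for the same order coincide.
above-transfer : (A B : Region m) → σ A ≈ₚ σ B → ∀ i → ℓᵢ A i ≡ ℓᵢ B i → ∀ j → inject₁ i Fin.< j →
  x A (inject₁ i) -ℝ x A j <ℝ y A i → x B (inject₁ i) -ℝ x B j <ℝ y B i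
above-transfer A B σ≈ i ℓ≡ j i<j lt with above? B i j
... | yes (_ , lt′) = lt′
... | no ¬above = contradiction (sym ℓ≡)
        (ℕ.<⇒≢ (count-strict (above? B i) (above? A i) B⊆A j ¬above (i<j , lt)))
  where
  -- Suppose j is missing from the set of B. A member k with xₖ < xⱼ would force j into that set, so
  -- every member lies beyond j and hence belongs to the set of A, which has j in addition.
  B⊆A : ∀ k → inject₁ i Fin.< k × x B (inject₁ i) -ℝ x B k <ℝ y B i →
        inject₁ i Fin.< k × x A (inject₁ i) -ℝ x A k <ℝ y A i
  B⊆A k (i<k , lt′) with k Fin.≟ j
  ... | yes refl = contradiction (i<k , lt′) ¬above
  ... | no k≢j with off⇒# (Region.point A) (Region.off A) k≢j
  ...   | inj₁ xk<xj = contradiction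
          (i<j , <ℝ-trans (sub-antimono-< (x B (inject₁ i)) (order-transfer A B σ≈ k j xk<xj)) lt′) ¬above
  ...   | inj₂ xj<xk = i<k , <ℝ-trans (sub-antimono-< (x A (inject₁ i)) xj<xk) lt

-- Both points lie in `Cell A`, which is convex, hence connected, and avoids the hyperplanes.
same-invariants : (A B : Region m) → σ A ≈ₚ σ B → τ A ≈ₚ τ B → A ∼ B
same-invariants {m} A B σ≈ τ≈ =
  Cell A , convex⇒connected (cell-convex A) , (λ {z} → cell-off A {z}) , cell-self A ,
  (order-transfer A B σ≈ , λ i j i<j → above-transfer A B σ≈ i (ℓ≡ i) j i<j , below i j i<j)
  where
  ℓ≡ : ∀ i → ℓᵢ A i ≡ ℓᵢ B i
  ℓ≡ i = trans (sym (lehmer-τ A i)) (trans (lehmer-cong {π = τ A} {τ B} τ≈ (inject₁ i)) (lehmer-τ B i))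
  below : ∀ i j → inject₁ i Fin.< j → y A i <ℝ x A (inject₁ i) -ℝ x A j → y B i <ℝ x B (inject₁ i) -ℝ x B j
  below i j i<j gt with proj₂ (Region.off B) i<j
  ... | inj₂ gt′ = gt′
  ... | inj₁ lt  = contradiction (above-transfer B A (sym ∘ σ≈) i (sym (ℓ≡ i)) j i<j lt) (<ℝ-asym gt)

-- Lowering w by one admits at most one more element, so the count passes through every value up to
-- `count P?`.
threshold : {P : Pred (Fin n) 0ℓ} (P? : Decidable P) → ∀ c → c ℕ.≤ count P? →
            ∃[ w ] count (λ v → P? v ×-dec (w ℕ.≤? toℕ v)) ≡ c
threshold {zero}  P? .0 z≤n = 0 , refl
threshold {suc n} P? c c≤ with c ℕ.≤? count (P? ∘ suc)
... | yes c≤′ = let (w , eq) = threshold (P? ∘ suc) c c≤′ in suc w , trans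
        (cong₂ ℕ._+_ (indicator-no (P? zero ×-dec (suc w ℕ.≤? 0)) (λ ()))
          (count-cong (λ v → P? (suc v) ×-dec (suc w ℕ.≤? suc (toℕ v))) (λ v → P? (suc v) ×-dec (w ℕ.≤? toℕ v))
             (λ { _ (p , le) → p , ℕ.s≤s⁻¹ le }) (λ { _ (p , le) → p , s≤s le })))
        eq
... | no c≰ = 0 , trans
        (count-cong (λ v → P? v ×-dec (0 ℕ.≤? toℕ v)) P? (λ _ → proj₁) (λ _ p → p , z≤n))
        (ℕ.≤-antisym (ℕ.≤-trans (ℕ.+-monoˡ-≤ (count (P? ∘ suc)) (indicator≤1 (P? zero))) (ℕ.≰⇒> c≰)) c≤)

fromℚ-mono-< : ∀ {p q} → p ℚ.< q → fromℚ p <ℝ fromℚ q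
fromℚ-mono-< {p} {q} p<q = gap (half (q ℚ.- p)) (half>0 0<q-p) 0 λ _ _ →
  subst (p ℚ.+ half (q ℚ.- p) ℚ.<_) (cancel p q) (ℚ.+-monoʳ-< p (half<self 0<q-p))
  where
  open +-*-Solver
  0<q-p : 0ℚ ℚ.< q ℚ.- p
  0<q-p = subst (ℚ._< q ℚ.- p) (ℚ.+-inverseʳ p) (shift-< p q (ℚ.- p) p<q)
  cancel : ∀ p q → p ℚ.+ (q ℚ.- p) ≡ q
  cancel = solve 2 (λ p q → p :+ (q :- p) := q) refl

fromℕℝ : ℕ → ℝ
fromℕℝ n = fromℚ (ℚ.mkℚ (ℤ.+ n) 0 (ℕ.sym (ℕ.1-coprimeTo n)))

fromℕℝ-mono-< : ∀ {a b} → a ℕ.< b → fromℕℝ a <ℝ fromℕℝ b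
fromℕℝ-mono-< {a} {b} a<b = fromℚ-mono-< (ℚ.*<*
  (subst₂ ℤ._<_ (sym (ℤ.*-identityʳ (ℤ.+ a))) (sym (ℤ.*-identityʳ (ℤ.+ b))) (ℤ.+<+ a<b)))

-- A region with prescribed invariants

module Realise (s t : Permutation′ (suc m)) where

  rank : Fin (suc m) → ℕ
  rank j = toℕ (s ⟨$⟩ˡ j)

  lehmer≤ : ∀ i → lehmer t i ℕ.≤ count (λ v → i Fin.<? (s ⟨$⟩ʳ v))
  lehmer≤ i = ℕ.≤-trans
    (count-mono (λ j → (i Fin.<? j) ×-dec ((t ⟨$⟩ʳ j) Fin.<? (t ⟨$⟩ʳ i))) (i Fin.<?_) (λ _ → proj₁))
    (ℕ.≤-reflexive (sym (count-permute (i Fin.<?_) s)))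

  -- A place in the order s such that exactly `lehmer t (inject₁ i)` of the indices j > i stand at
  -- or after it.
  cut : Fin m → ℕ
  cut i = proj₁ (threshold (λ v → inject₁ i Fin.<? (s ⟨$⟩ʳ v)) (lehmer t (inject₁ i)) (lehmer≤ (inject₁ i)))

  cut-count : ∀ i → count (λ j → (inject₁ i Fin.<? j) ×-dec (cut i ℕ.≤? rank j)) ≡ lehmer t (inject₁ i)
  cut-count i = trans (sym (count-permute (λ j → (inject₁ i Fin.<? j) ×-dec (cut i ℕ.≤? rank j)) s))
    (trans (count-cong (λ v → (inject₁ i Fin.<? (s ⟨$⟩ʳ v)) ×-dec (cut i ℕ.≤? rank (s ⟨$⟩ʳ v)))
                       (λ v → (inject₁ i Fin.<? (s ⟨$⟩ʳ v)) ×-dec (cut i ℕ.≤? toℕ v))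
              (λ { v (lt , le) → lt , subst (λ u → cut i ℕ.≤ toℕ u) (inverseˡ s) le })
              (λ { v (lt , le) → lt , subst (λ u → cut i ℕ.≤ toℕ u) (sym (inverseˡ s)) le }))
    (proj₂ (threshold (λ v → inject₁ i Fin.<? (s ⟨$⟩ʳ v)) (lehmer t (inject₁ i)) (lehmer≤ (inject₁ i)))))

  -- The xⱼ are odd and the cuts xᵢ - yᵢ even, so that no two of them meet.
  X : Fin (suc m) → ℝ
  X j = fromℕℝ (suc (2 ℕ.* rank j))

  Z Y : Fin m → ℝ
  Z i = fromℕℝ (2 ℕ.* cut i)
  -- With this choice xᵢ - xⱼ < yᵢ says that xⱼ lies beyond the cut `Z i`.
  Y i = X (inject₁ i) -ℝ Z i

  X-mono : ∀ {i j} → rank i ℕ.< rank j → X i <ℝ X j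
  X-mono lt = fromℕℝ-mono-< (s≤s (ℕ.*-monoʳ-< 2 lt))

  Z<X : ∀ i j → cut i ℕ.≤ rank j → X (inject₁ i) -ℝ X j <ℝ Y i
  Z<X i j le = sub-antimono-< (X (inject₁ i)) (fromℕℝ-mono-< {2 ℕ.* cut i} {suc (2 ℕ.* rank j)} (s≤s (ℕ.*-monoʳ-≤ 2 le)))

  X<Z : ∀ i j → rank j ℕ.< cut i → Y i <ℝ X (inject₁ i) -ℝ X j
  X<Z i j lt = sub-antimono-< (X (inject₁ i)) (fromℕℝ-mono-< {suc (2 ℕ.* rank j)} {2 ℕ.* cut i}
    (ℕ.≤-trans (ℕ.≤-reflexive (sym (ℕ.*-suc 2 (rank j)))) (ℕ.*-monoʳ-≤ 2 lt)))

  coordinates : ℝ^ (suc m ℕ.+ m)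
  coordinates k = [ X , Y ]′ (splitAt (suc m) k)

  x≡ : ∀ i → xᶜ m coordinates i ≡ X i
  x≡ i = cong [ X , Y ]′ (Fin.splitAt-↑ˡ (suc m) i m)

  y≡ : ∀ i → yᶜ m coordinates i ≡ Y i
  y≡ i = cong [ X , Y ]′ (Fin.splitAt-↑ʳ (suc m) m i)

  generic : OffHyperplanes m coordinates
  generic = offx , offy
    where
    offx : ∀ {i j : Fin (suc m)} → i Fin.< j → (xᶜ m coordinates i -ℝ xᶜ m coordinates j) # 0ℝ
    offx {i} {j} i<j = subst₂ (λ u v → (u -ℝ v) # 0ℝ) (sym (x≡ i)) (sym (x≡ j))
      (choose (ℕ.<-cmp (rank i) (rank j)))
      where
      choose : Tri (rank i ℕ.< rank j) (rank i ≡ rank j) (rank j ℕ.< rank i) → (X i -ℝ X j) # 0ℝ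
      choose (tri< lt _ _) = inj₁ (<⇒sub<0 (X i) (X j) (X-mono {i} {j} lt))
      choose (tri≈ _ eq _) = contradiction (injective (flip s) (Fin.toℕ-injective eq)) (Fin.<⇒≢ i<j)
      choose (tri> _ _ gt) = inj₂ (>⇒0<sub (X i) (X j) (X-mono {j} {i} gt))
    offy : ∀ {i : Fin m} {j : Fin (suc m)} → inject₁ i Fin.< j →
           (xᶜ m coordinates (inject₁ i) -ℝ xᶜ m coordinates j) # yᶜ m coordinates i
    offy {i} {j} i<j = subst₂ _#_ (sym (cong₂ _-ℝ_ (x≡ (inject₁ i)) (x≡ j))) (sym (y≡ i))
      (choose (cut i ℕ.≤? rank j))
      where
      choose : Dec (cut i ℕ.≤ rank j) → (X (inject₁ i) -ℝ X j) # Y i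
      choose (yes le) = inj₁ (Z<X i j le)
      choose (no c≰r) = inj₂ (X<Z i j (ℕ.≰⇒> c≰r))

  region : Region m
  region = record { point = coordinates ; off = generic }

  σ-region : σ region ≈ₚ s
  σ-region = sorted-unique (λ i j → x region i <ℝ x region j) <ℝ-asym (σ region) s (σ-sorts region) sorted
    where
    sorted : ∀ {i j} → i Fin.< j → x region (s ⟨$⟩ʳ i) <ℝ x region (s ⟨$⟩ʳ j)
    sorted {i} {j} i<j = subst₂ _<ℝ_ (sym (x≡ (s ⟨$⟩ʳ i))) (sym (x≡ (s ⟨$⟩ʳ j)))
      (X-mono {s ⟨$⟩ʳ i} {s ⟨$⟩ʳ j} (subst₂ Fin._<_ (sym (inverseˡ s)) (sym (inverseˡ s)) i<j))

  ℓ-region : ∀ i → ℓᵢ region i ≡ lehmer t (inject₁ i)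
  ℓ-region i = trans
    (count-cong (above? region i) (λ j → (inject₁ i Fin.<? j) ×-dec (cut i ℕ.≤? rank j))
      (λ { j (i<j , lt) → i<j , ℕ.≮⇒≥ (λ r<c → <ℝ-asym (X<Z i j r<c) (subst₂ _<ℝ_ (diff≡ j) (y≡ i) lt)) })
      (λ { j (i<j , le) → i<j , subst₂ _<ℝ_ (sym (diff≡ j)) (sym (y≡ i)) (Z<X i j le) }))
    (cut-count i)
    where
    diff≡ : ∀ j → x region (inject₁ i) -ℝ x region j ≡ X (inject₁ i) -ℝ X j
    diff≡ j = cong₂ _-ℝ_ (x≡ (inject₁ i)) (x≡ j)

  τ-region : τ region ≈ₚ t
  τ-region = lehmer-injective (τ region) t code
    where
    code : ∀ i → lehmer (τ region) i ≡ lehmer t i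
    code i with view i
    ... | ‵fromℕ     = trans (lehmer-last (τ region)) (sym (lehmer-last t))
    ... | ‵inject₁ j = trans (lehmer-τ region j) (ℓ-region j)

-- Enumerations

module _ {a ℓ₁ b ℓ₂} {S : Setoid a ℓ₁} {T : Setoid b ℓ₂} where
  private
    module S = Setoid S
    module T = Setoid T

  strictInverse : (to : S.Carrier → T.Carrier) (from : T.Carrier → S.Carrier) →
    (∀ {x y} → x S.≈ y → to x T.≈ to y) → (∀ {x y} → x T.≈ y → from x S.≈ from y) →
    (∀ y → to (from y) T.≈ y) → (∀ x → from (to x) S.≈ x) → Inverse S T
  strictInverse to from to-cong from-cong invˡ invʳ = record
    { to = to ; from = from ; to-cong = to-cong ; from-cong = from-cong
    ; inverse = Consequences.strictlyInverseˡ⇒inverseˡ S T to-cong invˡ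
              , Consequences.strictlyInverseʳ⇒inverseʳ S T from-cong invʳ }

  transport : Enumeration S → Inverse S T → Enumeration T
  transport (N , e) f = N , Composition.inverse e f

  ×-enumeration : Enumeration S → Enumeration T → Enumeration (×-setoid S T)
  ×-enumeration (N , e) (M , f) = N ℕ.* M , record
    { to        = λ k → E.to (proj₁ (remQuot {N} M k)) , F.to (proj₂ (remQuot {N} M k))
    ; from      = λ (x , y) → combine (E.from x) (F.from y)
    ; to-cong   = λ { refl → S.refl , T.refl }
    ; from-cong = λ (p , q) → cong₂ combine (E.from-cong p) (F.from-cong q)
    ; inverse   =
        (λ { {x , y} refl →
             S.trans (S.reflexive (cong (E.to ∘ proj₁) (Fin.remQuot-combine (E.from x) (F.from y)))) (E.strictlyInverseˡ x) ,
             T.trans (T.reflexive (cong (F.to ∘ proj₂) (Fin.remQuot-combine (E.from x) (F.from y)))) (F.strictlyInverseˡ y) }) ,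
        (λ { {k} (p , q) → trans (cong₂ combine (E.inverseʳ p) (F.inverseʳ q)) (Fin.combine-remQuot {N} M k) })
    }
    where
    module E = Inverse e
    module F = Inverse f

-- Enumeration of permutations by the image of zero

Perms : ℕ → Setoid 0ℓ 0ℓ
Perms n = record
  { Carrier       = Permutation′ n
  ; _≈_           = _≈ₚ_
  ; isEquivalence = record
    { refl  = λ _ → refl
    ; sym   = λ p i → sym (p i)
    ; trans = λ p q i → trans (p i) (q i)
    }
  }

-- `_∘ₚ_` applies its left argument first, so zero goes to k and k can be read off from the result.
extend : Fin (suc n) → Permutation′ n → Permutation′ (suc n)
extend k π = lift₀ π ∘ₚ transpose zero k

restrict : Permutation′ (suc n) → Permutation′ n
restrict ρ = remove zero (ρ ∘ₚ transpose (ρ ⟨$⟩ʳ zero) zero)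

-- Undoing the transposition makes zero a fixed point, so nothing is lost by removing it.
lift₀-restrict : (ρ : Permutation′ (suc n)) → lift₀ (restrict ρ) ≈ₚ ρ ∘ₚ transpose (ρ ⟨$⟩ʳ zero) zero
lift₀-restrict ρ = lift₀-remove (ρ ∘ₚ transpose (ρ ⟨$⟩ʳ zero) zero) fixes-zero
  where
  fixes-zero : PC.transpose (ρ ⟨$⟩ʳ zero) zero (ρ ⟨$⟩ʳ zero) ≡ zero
  fixes-zero rewrite dec-true (ρ ⟨$⟩ʳ zero Fin.≟ ρ ⟨$⟩ʳ zero) refl = refl

extend-inverse : ∀ n → Inverse (×-setoid (setoid (Fin (suc n))) (Perms n)) (Perms (suc n))
extend-inverse n = strictInverse (λ (k , π) → extend k π) (λ ρ → ρ ⟨$⟩ʳ zero , restrict ρ)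
  (λ { {k , π} {_ , ρ} (refl , eq) i → cong (PC.transpose zero k) (Perm.lift₀-cong π ρ eq i) })
  (λ {ρ} {ρ′} eq → eq zero , λ i → Fin.suc-injective
     (trans (lift₀-restrict ρ (suc i))
       (trans (cong₂ (λ k → PC.transpose k zero) (eq zero) (eq (suc i))) (sym (lift₀-restrict ρ′ (suc i))))))
  (λ ρ i → trans (cong (PC.transpose zero (ρ ⟨$⟩ʳ zero)) (lift₀-restrict ρ i)) (PC.transpose-inverse zero (ρ ⟨$⟩ʳ zero)))
  (λ (k , π) → refl , λ i → Fin.suc-injective
     (trans (lift₀-restrict (extend k π) (suc i)) (PC.transpose-inverse k zero)))

permutations : ∀ n → Enumeration (Perms n)
permutations zero    = 1 , strictInverse (λ _ → idₚ) (λ _ → zero) (λ _ _ → refl) (λ _ → refl) (λ _ ()) (λ { zero → refl })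
permutations (suc n) =
  transport (×-enumeration (suc n , Identity.inverse (setoid (Fin (suc n)))) (permutations n)) (extend-inverse n)

-- Regions as pairs of permutations

στ-cong : {A B : Region m} → A ∼ B → σ A ≈ₚ σ B × τ A ≈ₚ τ B
στ-cong {m} {A} {B} A∼B =
  sorted-unique (λ i j → x A i <ℝ x A j) <ℝ-asym (σ A) (σ B) (σ-sorts A) (proj₂ (σ-exists B) A A∼B) ,
  lehmer-injective (τ A) (τ B) code
  where
  code : ∀ i → lehmer (τ A) i ≡ lehmer (τ B) i
  code i with view i
  ... | ‵fromℕ     = trans (lehmer-last (τ A)) (sym (lehmer-last (τ B)))
  ... | ‵inject₁ j = trans (lehmer-τ A j) (trans (ℓᵢ-cong {A = A} {B} A∼B j) (sym (lehmer-τ B j)))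

-- The map f read backwards: `Realise` makes f surjective and `same-invariants` makes it injective.
region-inverse : ∀ m → Inverse (×-setoid (Perms (suc m)) (Perms (suc m))) (HS m)
region-inverse m = strictInverse (uncurry Realise.region) (λ A → σ A , τ A)
  (λ { {s , t} {s′ , t′} (p , q) → same-invariants (Realise.region s t) (Realise.region s′ t′)
       (λ i → trans (Realise.σ-region s t i) (trans (p i) (sym (Realise.σ-region s′ t′ i))))
       (λ i → trans (Realise.τ-region s t i) (trans (q i) (sym (Realise.τ-region s′ t′ i)))) })
  (λ {A} {B} → στ-cong {A = A} {B})
  (λ A → same-invariants (Realise.region (σ A) (τ A)) A (Realise.σ-region (σ A) (τ A)) (Realise.τ-region (σ A) (τ A)))
  (λ (s , t) → Realise.σ-region s t , Realise.τ-region s t)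

regions : ∀ m → Enumeration (HS m)
regions m = transport (×-enumeration (permutations (suc m)) (permutations (suc m))) (region-inverse m)

-- Sums over permutations and regions

module _ {c ℓ} (M : CommutativeMonoid c ℓ) where
  open CommutativeMonoid M renaming (refl to ≈-refl; sym to ≈-sym; trans to ≈-trans)
  open Sum M using (sum)

  sum-++ : ∀ a {b} (f : Fin (a ℕ.+ b) → Carrier) → sum f ≈ sum (λ i → f (i ↑ˡ b)) ∙ sum (λ j → f (a ↑ʳ j))
  sum-++ zero    f = ≈-sym (identityˡ _)
  sum-++ (suc a) f = ≈-trans (∙-congˡ (sum-++ a (f ∘ suc))) (≈-sym (assoc _ _ _))

  sum-combine : ∀ a b (f : Fin (a ℕ.* b) → Carrier) → sum f ≈ sum {a} (λ i → sum {b} (λ j → f (combine i j)))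
  sum-combine zero    b f = ≈-refl
  sum-combine (suc a) b f = ≈-trans (sum-++ b f) (∙-congˡ (sum-combine a b (f ∘ (b ↑ʳ_))))

module _ {c ℓ} (K : CommutativeRing c ℓ) where
  private
    module K = CommutativeRing K
    open K using (_+_; 1#; -_)
    open Weights K
    open Sum K.+-commutativeMonoid using (sum; sum-cong-≋; sum-permute; sum-replicate)
    module ∏ = Sum K.*-commutativeMonoid
    open SemiringSum K.semiring using (*-distribˡ-sum; *-distribʳ-sum)
    open Exp K.semiring using (^-homo-*; ^-assocʳ; ^-congʳ; ^-congˡ)
    open RingProperties K.ring using (-1*x≈-x; -‿distribˡ-*; -‿distribʳ-*; -‿involutive)
    open SetoidReasoning K.setoid

  -- Two enumerations differ by the bijection F⁻¹E of their index sets, so any convenient one may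
  -- compute the sum.
  sumOver-unique : ∀ {a ℓ′} {S : Setoid a ℓ′} (E F : Enumeration S) (g : Setoid.Carrier S → Carrier) →
    (∀ {x y} → Setoid._≈_ S x y → g x ≈ g y) → sumOver E g ≈ sumOver F g
  sumOver-unique {S = S} (N , e) (M , f) g g-cong = begin
    sum (λ k → g (E.to k))                     ≈⟨ sum-cong-≋ (λ k → g-cong (Setoid.sym S (F.strictlyInverseˡ (E.to k)))) ⟩
    sum (λ k → g (F.to (F.from (E.to k))))     ≈⟨ K.sym (sum-permute (λ k → g (F.to k)) (Composition.inverse e (Symmetry.inverse f))) ⟩
    sum (λ k → g (F.to k))                     ∎
    where
    module E = Inverse e
    module F = Inverse f

  sumOver-× : ∀ {a ℓ₁ b ℓ₂} {S : Setoid a ℓ₁} {T : Setoid b ℓ₂} (E : Enumeration S) (F : Enumeration T)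
    (g : Setoid.Carrier S × Setoid.Carrier T → Carrier) →
    sumOver (×-enumeration E F) g ≈ sumOver E (λ x → sumOver F (λ y → g (x , y)))
  sumOver-× (N , e) (M , f) g = K.trans
    (sum-combine K.+-commutativeMonoid N M (λ k → g′ (remQuot {N} M k)))
    (sum-cong-≋ (λ i → sum-cong-≋ (λ j → K.reflexive (cong g′ (Fin.remQuot-combine i j)))))
    where
    g′ : Fin N × Fin M → Carrier
    g′ (i , j) = g (Inverse.to e i , Inverse.to f j)

  sumOver-transport : ∀ {a ℓ₁ b ℓ₂} {S : Setoid a ℓ₁} {T : Setoid b ℓ₂}
    (E : Enumeration S) (i : Inverse S T) (R : Enumeration T)
    (f : Setoid.Carrier T → Carrier) (g : Setoid.Carrier S → Carrier) →
    (∀ {x y} → Setoid._≈_ T x y → f x ≈ f y) → (∀ x → f (Inverse.to i x) ≈ g x) →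
    sumOver R f ≈ sumOver E g
  sumOver-transport E i R f g f-cong f≈g = K.trans
    (sumOver-unique R (transport E i) f f-cong)
    (sum-cong-≋ (λ k → f≈g (Inverse.to (proj₂ E) k)))

  sumOver-regions : ∀ m (R : Enumeration (HS m)) (g : Permutation′ (suc m) × Permutation′ (suc m) → Carrier) →
    (∀ s s′ r r′ → s ≈ₚ s′ → r ≈ₚ r′ → g (s , r) ≈ g (s′ , r′)) →
    sumOver R (λ A → g (σ A , τ A)) ≈ sumOver (×-enumeration (permutations (suc m)) (permutations (suc m))) g
  sumOver-regions m R g g-cong = sumOver-transport
    (×-enumeration (permutations (suc m)) (permutations (suc m))) (region-inverse m) R (λ A → g (σ A , τ A)) g
    (λ {A} {B} A∼B → let (p , q) = στ-cong {A = A} {B} A∼B in g-cong (σ A) (σ B) (τ A) (τ B) p q)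
    (λ (s , r) → g-cong (σ (Realise.region s r)) s (τ (Realise.region s r)) r (Realise.σ-region s r) (Realise.τ-region s r))

  -- Signs

  -1^2 : (- 1#) ^ 2 ≈ 1#
  -1^2 = begin
    - 1# * (- 1# * 1#)  ≈⟨ K.*-congˡ (K.*-identityʳ (- 1#)) ⟩
    - 1# * - 1#         ≈⟨ -1*x≈-x (- 1#) ⟩
    - - 1#              ≈⟨ -‿involutive 1# ⟩
    1#                  ∎

  1^n : ∀ n → 1# ^ n ≈ 1#
  1^n zero    = K.refl
  1^n (suc n) = K.trans (K.*-identityˡ (1# ^ n)) (1^n n)

  -1^even : ∀ n → (- 1#) ^ (2 ℕ.* n) ≈ 1#
  -1^even n = begin
    (- 1#) ^ (2 ℕ.* n)  ≈⟨ K.sym (^-assocʳ (- 1#) 2 n) ⟩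
    ((- 1#) ^ 2) ^ n    ≈⟨ ^-congˡ n -1^2 ⟩
    1# ^ n              ≈⟨ 1^n n ⟩
    1#                  ∎

  sgn-cong : {π ρ : Permutation′ n} → π ≈ₚ ρ → sgn π ≈ sgn ρ
  sgn-cong {π = π} {ρ} eq = ^-congʳ (- 1#) (inversions-cong {π = π} {ρ} eq)

  -- The exponents on the two sides differ by an even number, which enters as a factor 1.
  sgn-∘ : (π ρ : Permutation′ n) → sgn (π ∘ₚ ρ) ≈ sgn π * sgn ρ
  sgn-∘ π ρ with inversions-∘ π ρ
  ... | d , eq = begin
    sgn (π ∘ₚ ρ)                                         ≈⟨ K.sym (K.*-identityʳ _) ⟩
    sgn (π ∘ₚ ρ) * 1#                                    ≈⟨ K.*-congˡ (K.sym (-1^even d)) ⟩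
    sgn (π ∘ₚ ρ) * (- 1#) ^ (2 ℕ.* d)                    ≈⟨ K.sym (^-homo-* (- 1#) (inversions (π ∘ₚ ρ)) (2 ℕ.* d)) ⟩
    (- 1#) ^ (inversions (π ∘ₚ ρ) ℕ.+ 2 ℕ.* d)           ≈⟨ ^-congʳ (- 1#) eq ⟩
    (- 1#) ^ (inversions π ℕ.+ inversions ρ)             ≈⟨ ^-homo-* (- 1#) (inversions π) (inversions ρ) ⟩
    sgn π * sgn ρ                                        ∎

  sgn-square : (π : Permutation′ n) → sgn π * sgn π ≈ 1#
  sgn-square π = begin
    sgn π * sgn π                              ≈⟨ K.sym (^-homo-* (- 1#) (inversions π) (inversions π)) ⟩
    (- 1#) ^ (inversions π ℕ.+ inversions π)   ≈⟨ ^-congʳ (- 1#) (cong (inversions π ℕ.+_) (sym (ℕ.+-identityʳ (inversions π)))) ⟩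
    (- 1#) ^ (2 ℕ.* inversions π)              ≈⟨ -1^even (inversions π) ⟩
    1#                                         ∎

  -- Every such transposition is a conjugate of (0 1) by an involution γ, whose sign occurs twice
  -- and cancels.
  sgn-transpose : (k : Fin n) → sgn (transpose zero (suc k)) ≈ - 1#
  sgn-transpose {suc n} zero    =
    K.trans (^-congʳ (- 1#) (inversions-transpose₀₁ {n})) (K.*-identityʳ (- 1#))
  sgn-transpose {suc n} (suc k) = begin
    sgn (transpose zero (suc (suc k)))  ≈⟨ sgn-cong {π = transpose zero (suc (suc k))} {(γ ∘ₚ τ₀) ∘ₚ γ} (transpose-conj k) ⟩
    sgn ((γ ∘ₚ τ₀) ∘ₚ γ)                ≈⟨ sgn-∘ (γ ∘ₚ τ₀) γ ⟩
    sgn (γ ∘ₚ τ₀) * sgn γ               ≈⟨ K.*-congʳ (K.trans (sgn-∘ γ τ₀) (K.*-comm (sgn γ) (sgn τ₀))) ⟩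
    (sgn τ₀ * sgn γ) * sgn γ            ≈⟨ K.*-assoc (sgn τ₀) (sgn γ) (sgn γ) ⟩
    sgn τ₀ * (sgn γ * sgn γ)            ≈⟨ K.*-cong (sgn-transpose {suc n} zero) (sgn-square γ) ⟩
    - 1# * 1#                           ≈⟨ K.*-identityʳ (- 1#) ⟩
    - 1#                                ∎
    where
    γ τ₀ : Permutation′ (suc (suc n))
    γ  = lift₀ (transpose zero (suc k))
    τ₀ = transpose zero (suc zero)

  sum-const : ∀ k x → sum {k} (λ _ → x) ≈ ι k * x
  sum-const k x = begin
    sum {k} (λ _ → x)        ≈⟨ sum-cong-≋ {k} (λ _ → K.sym (K.*-identityˡ x)) ⟩
    sum {k} (λ _ → 1# * x)   ≈⟨ K.sym (*-distribʳ-sum {k} x (λ _ → 1#)) ⟩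
    sum {k} (λ _ → 1#) * x   ≈⟨ K.*-congʳ (sum-replicate k) ⟩
    ι k * x                  ∎

  sum-neg : ∀ {k} (g : Fin k → Carrier) → sum (λ i → - g i) ≈ - sum g
  sum-neg g = begin
    sum (λ i → - g i)         ≈⟨ sum-cong-≋ (λ i → K.sym (-1*x≈-x (g i))) ⟩
    sum (λ i → - 1# * g i)    ≈⟨ K.sym (*-distribˡ-sum (- 1#) g) ⟩
    - 1# * sum g              ≈⟨ -1*x≈-x (sum g) ⟩
    - sum g                   ∎

  ∏-last : ∀ m (g : ℕ → Carrier) → ∏₁ (suc m) g ≈ ∏₁ m g * g (suc m)
  ∏-last m g = K.trans (∏.sum-init-last (λ (i : Fin (suc m)) → g (suc (toℕ i))))
    (K.reflexive (cong₂ _*_ (∏.sum-cong-≗ (λ (i : Fin m) → cong (g ∘ suc) (Fin.toℕ-inject₁ i)))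
                            (cong (g ∘ suc) (Fin.toℕ-fromℕ m))))

  -- The generating function of signs and cycles

  module _ (t : Carrier) where

    -- The exponent is lowered so that the -1 in the exponent of a pair leaves exactly one common
    -- factor t.
    weight : Permutation′ n → Carrier
    weight π = sgn π * t ^ (cyc π ∸ 1)

    -- A new cycle raises the exponent by one because `cyc π` is already positive on `Fin (suc n)`;
    -- on `Fin 0` the subtraction would truncate. This is why the induction starts with one point.
    weight-extend-zero : (π : Permutation′ (suc n)) → weight (extend zero π) ≈ t * weight π
    weight-extend-zero π = begin
      sgn (extend zero π) * t ^ (cyc (extend zero π) ∸ 1)
        ≈⟨ K.*-cong (K.trans (sgn-cong {π = extend zero π} {lift₀ π} trivial) (^-congʳ (- 1#) (inversions-lift₀ π)))
                    (^-congʳ t (cong (_∸ 1) (trans (cyc-cong {π = extend zero π} {lift₀ π} trivial) (cyc-lift₀ π)))) ⟩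
      sgn π * (t * t ^ (cyc π ∸ 1))   ≈⟨ K.sym (K.*-assoc (sgn π) t _) ⟩
      sgn π * t * t ^ (cyc π ∸ 1)     ≈⟨ K.*-congʳ (K.*-comm (sgn π) t) ⟩
      t * sgn π * t ^ (cyc π ∸ 1)     ≈⟨ K.*-assoc t (sgn π) _ ⟩
      t * weight π                    ∎
      where
      trivial : extend zero π ≈ₚ lift₀ π
      trivial zero    = refl
      trivial (suc i) = refl

    weight-extend-suc : (k : Fin n) (π : Permutation′ n) → weight (extend (suc k) π) ≈ - weight π
    weight-extend-suc k π = begin
      sgn (extend (suc k) π) * t ^ (cyc (extend (suc k) π) ∸ 1)
        ≈⟨ K.*-cong (sgn-∘ (lift₀ π) (transpose zero (suc k))) (^-congʳ t (cong (_∸ 1) (InsertZero.cyc-π⁺ π k))) ⟩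
      sgn (lift₀ π) * sgn (transpose zero (suc k)) * T
        ≈⟨ K.*-congʳ (K.*-cong (^-congʳ (- 1#) (inversions-lift₀ π)) (sgn-transpose k)) ⟩
      sgn π * - 1# * T   ≈⟨ K.*-congʳ (K.trans (K.*-comm (sgn π) (- 1#)) (-1*x≈-x (sgn π))) ⟩
      - sgn π * T        ≈⟨ K.sym (-‿distribˡ-* (sgn π) T) ⟩
      - weight π         ∎
      where
      T = t ^ (cyc π ∸ 1)

    sumOver-extend : (f : Permutation′ (suc n) → Carrier) (g : Permutation′ n → Carrier) →
      (∀ π → f (extend zero π) ≈ t * g π) → (∀ k π → f (extend (suc k) π) ≈ - g π) →
      sumOver (permutations (suc n)) f ≈ sumOver (permutations n) g * (t - ι n)
    sumOver-extend {n} f g f-zero f-suc = begin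
      sumOver (permutations (suc n)) f
        ≈⟨ sumOver-× (suc n , Identity.inverse (setoid (Fin (suc n)))) Π (λ (k , π) → f (extend k π)) ⟩
      sumOver Π (λ π → f (extend zero π)) + sum {n} (λ k → sumOver Π (λ π → f (extend (suc k) π)))
        ≈⟨ K.+-cong (sum-cong-≋ (λ i → f-zero (P i))) (sum-cong-≋ {n} (λ k → sum-cong-≋ (λ i → f-suc k (P i)))) ⟩
      sumOver Π (λ π → t * g π) + sum {n} (λ _ → sumOver Π (λ π → - g π))
        ≈⟨ K.+-cong (K.sym (*-distribˡ-sum t (λ i → g (P i)))) (sum-const n _) ⟩
      t * S + ι n * sumOver Π (λ π → - g π)
        ≈⟨ K.+-congˡ (K.*-congˡ (sum-neg (λ i → g (P i)))) ⟩
      t * S + ι n * - S    ≈⟨ K.+-congˡ (K.trans (K.sym (-‿distribʳ-* (ι n) S)) (-‿distribˡ-* (ι n) S)) ⟩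
      t * S + - ι n * S    ≈⟨ K.sym (K.distribʳ S t (- ι n)) ⟩
      (t - ι n) * S        ≈⟨ K.*-comm _ S ⟩
      S * (t - ι n)        ∎
      where
      Π = permutations n
      P = Inverse.to (proj₂ Π)
      S = sumOver Π g

    -- Multiplied by t, this is the falling factorial t (t - 1) ... (t - m), the signed cycle
    -- generating function of m + 1 points. For one point both sides are 1.
    weight-sum : ∀ m → sumOver (permutations (suc m)) weight ≈ ∏[1≤ i ≤ m ] (t - ι i)
    weight-sum zero    = K.trans (K.+-identityʳ _) (K.*-identityˡ 1#)
    weight-sum (suc m) = K.trans
      (sumOver-extend {suc m} weight weight weight-extend-zero weight-extend-suc)
      (K.trans (K.*-congʳ (weight-sum m)) (K.sym (∏-last m (λ i → t - ι i))))

    pair-weight : Permutation′ m × Permutation′ n → Carrier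
    pair-weight (s , r) = (sgn s * sgn r) * t ^ (cyc s ℕ.+ cyc r ∸ 1)

    pair-weight≈ : (s : Permutation′ (suc m)) (r : Permutation′ (suc n)) →
                   pair-weight (s , r) ≈ t * (weight s * weight r)
    pair-weight≈ s r = begin
      -- Both cycle counts compute to successors, `suc a` and `suc b`, so the subtraction removes
      -- one of them and the other supplies the factor t.
      (sgn s * sgn r) * t ^ (a ℕ.+ suc b)      ≈⟨ K.*-congˡ (K.trans (^-congʳ t (ℕ.+-suc a b)) (K.*-congˡ (^-homo-* t a b))) ⟩
      (sgn s * sgn r) * (t * (t ^ a * t ^ b))  ≈⟨ K.sym (K.*-assoc (sgn s * sgn r) t _) ⟩
      (sgn s * sgn r) * t * (t ^ a * t ^ b)    ≈⟨ K.*-congʳ (K.*-comm (sgn s * sgn r) t) ⟩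
      t * (sgn s * sgn r) * (t ^ a * t ^ b)    ≈⟨ K.*-assoc t _ _ ⟩
      t * ((sgn s * sgn r) * (t ^ a * t ^ b))  ≈⟨ K.*-congˡ (interchange (sgn s) (sgn r) (t ^ a) (t ^ b)) ⟩
      t * (weight s * weight r)                ∎
      where
      a = cyc s ∸ 1
      b = cyc r ∸ 1
      open CommutativeSemigroup K.*-commutativeSemigroup using (interchange)

    weight-² : ∀ m → (∏[1≤ i ≤ m ] (t - ι i)) * (∏[1≤ i ≤ m ] (t - ι i)) ≈ ∏[1≤ i ≤ m ] ((t - ι i) ^ 2)
    weight-² m = K.trans (K.sym (∏.∑-distrib-+ f f)) (∏.sum-cong-≋ (λ i → K.*-congˡ (K.sym (K.*-identityʳ (f i)))))
      where
      f : Fin m → Carrier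
      f i = t - ι (suc (toℕ i))

    sumOver-product : ∀ {a ℓ′} {S : Setoid a ℓ′} (E : Enumeration S)
      (f : Setoid.Carrier S × Setoid.Carrier S → Carrier) (g : Setoid.Carrier S → Carrier) →
      (∀ x y → f (x , y) ≈ t * (g x * g y)) → sumOver (×-enumeration E E) f ≈ t * (sumOver E g * sumOver E g)
    sumOver-product E@(_ , e) f g f≈ = begin
      sumOver (×-enumeration E E) f
        ≈⟨ sumOver-× E E f ⟩
      sum (λ i → sum (λ j → f (P i , P j)))
        ≈⟨ sum-cong-≋ (λ i → sum-cong-≋ (λ j → f≈ (P i) (P j))) ⟩
      sum (λ i → sum (λ j → t * (w i * w j)))
        ≈⟨ sum-cong-≋ (λ i → K.sym (*-distribˡ-sum t (λ j → w i * w j))) ⟩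
      sum (λ i → t * sum (λ j → w i * w j))
        ≈⟨ K.sym (*-distribˡ-sum t (λ i → sum (λ j → w i * w j))) ⟩
      t * sum (λ i → sum (λ j → w i * w j))
        ≈⟨ K.*-congˡ (sum-cong-≋ (λ i → K.sym (*-distribˡ-sum (w i) w))) ⟩
      t * sum (λ i → w i * sum w)
        ≈⟨ K.*-congˡ (K.sym (*-distribʳ-sum (sum w) w)) ⟩
      t * (sum w * sum w) ∎
      where
      P = Inverse.to e
      w = λ i → g (P i)

    pair-sum : ∀ m → let Π = permutations (suc m) in
               sumOver (×-enumeration Π Π) pair-weight ≈ t * ∏[1≤ i ≤ m ] ((t - ι i) ^ 2)
    pair-sum m = K.trans (sumOver-product (permutations (suc m)) pair-weight weight pair-weight≈)
      (K.*-congˡ (K.trans (K.*-cong (weight-sum m) (weight-sum m)) (weight-² m)))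

    pair-weight-cong : (s s′ : Permutation′ m) (r r′ : Permutation′ n) → s ≈ₚ s′ → r ≈ₚ r′ →
                       pair-weight (s , r) ≈ pair-weight (s′ , r′)
    pair-weight-cong s s′ r r′ p q = K.*-cong
      (K.*-cong (sgn-cong {π = s} {s′} p) (sgn-cong {π = r} {r′} q))
      (^-congʳ t (cong₂ (λ a b → a ℕ.+ b ∸ 1) (cyc-cong {π = s} {s′} p) (cyc-cong {π = r} {r′} q)))

    region-sum : ∀ m (R : Enumeration (HS m)) →
      sumOver R (λ A → pair-weight (σ A , τ A)) ≈ t * ∏[1≤ i ≤ m ] ((t - ι i) ^ 2)
    region-sum m R = K.trans (sumOver-regions m R pair-weight pair-weight-cong) (pair-sum m)

corollary5p4 : ∀ {c ℓ} (K : CommutativeRing c ℓ) →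
    let open Weights K in
    (t : Carrier) (m : ℕ) →
    Enumeration (HS m) ×
    ((R : Enumeration (HS m)) →
    ∑[ A ∈ R ] (ε A * t ^ (cyc (σ A) ℕ.+ cyc (τ A) ∸ 1))
    ≈ t * ∏[1≤ i ≤ m ] ((t - ι i) ^ 2))
corollary5p4 K t m = regions m , region-sum K t m
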